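{- Let $f$ be a step function whose search hits at every $n\in\mathbb N$, let $G=\mathcal A\cdot\mathrm{rrep}(f)$, and suppose $\emptyset\vdash G$ is not derivable in OGA. Then all of the following hold: (i) $\emptyset\vdash G\,\mathsf B$ is derivable in OGA; (ii) $\emptyset\vdash\neg G$ is not derivable in OGA; (iii) $\emptyset\vdash G$ is not derivable in OGA; (iv) $G$ is a genuine fiction; (v) the extension of OGA by $G$ proves no contradiction, i.e. there is no term $c$ with both $\{G\}\vdash c$ and $\{G\}\vdash\neg c$ derivable in OGA.
   Context: **Syntax.** Terms: $t::=v_i\mid\bot\mid\mathbf 0\mid\mathbf S t\mid t=t\mid\neg t\mid t\lor t\mid\lambda t\mid t\cdot t\mid\mathcal R\mid\mathcal A$ ($v_i$, $i\in\mathbb N$, de Bruijn variables; $\lambda$ is the only binder; application associates to the left). A term is well-formed (wf) if generated by this grammar. $\bot$ is a divergent constant, $\mathcal R$ the primitive recursor, $\mathcal A$ the universal quantifier. Abbreviations: $t\,\mathsf N$ is $t=t$; $t\,\mathsf B$ is $t\lor\neg t$; $t\ne u$ is $\neg(t=u)$; $t\land u$ is $\neg(\neg t\lor\neg u)$; $t\to u$ is $\neg t\lor u$; $\underline n=\mathbf S^n\mathbf 0$. $\uparrow$ shifts all free indices up by one; $b[t]$ is the $\beta$-instance substituting $t$ for the outermost bound variable of $b$; $[v\mapsto s]$ is capture-avoiding substitution for a free variable; $\mathrm{fv}$ is the set of free variables. **Head steps** $\triangleright$: $(\lambda b)\cdot t\triangleright b[t]$; $\mathcal R\cdot g\cdot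 h\cdot\mathbf 0\triangleright g$; $\mathcal R\cdot g\cdot h\cdot(\mathbf S\underline n)\triangleright h\cdot\underline n\cdot(\mathcal R\cdot g\cdot h\cdot\underline n)$; if $t\triangleright t'$ then $t\cdot u\triangleright t'\cdot u$. **Rules.** Judgments are $\Gamma\vdash c$, $\Gamma$ a finite set of wf terms, $c$ a wf term (all terms in rules are wf). A proof is a finite list of judgments each following from earlier entries by one rule; $\Gamma\vdash c$ is derivable if it occurs in a proof. Rules ("$\Rightarrow$" from premises to conclusion, "$\Leftrightarrow$" both directions; $\Gamma$ is the context of a judgment when none is shown): $\Gamma,c\vdash c$; $\Gamma\vdash c\Rightarrow\Gamma,a\vdash c$; $\Gamma\vdash a$ and $\Gamma,a\vdash c\Rightarrow\Gamma\vdash c$; $\Gamma\vdash c\Rightarrow[v\mapsto s]\Gamma\vdash[v\mapsto s]c$; $\vdash a\Leftrightarrow\ \vdash a=\underline1$; $\vdash\neg a\Leftrightarrow\ \vdash a=\underline0$; $\vdash\neg a,\ \vdash a\Rightarrow\ \vdash c$; $\vdash a\Leftrightarrow\ \vdash\neg\neg a$; $\vdash a\Rightarrow\ \vdash a\lor b$; $\vdash b\Rightarrow\ \vdash a\lor b$; $\vdash\neg a,\ \vdash\neg b\Rightarrow\ \vdash\neg(a\lor b)$; $\vdash a\lor b,\ \Gamma,a\vdash c,\ \Gamma,b\vdash c\Rightarrow\ \vdash c$; $\vdash\neg(a\lor b)\Rightarrow\ \vdash\neg a$; $\vdash\neg(a\lor b)\Rightarrow\ \vdash\neg b$; $\vdash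 a\,\mathsf N\Leftrightarrow\ \vdash a=a$; $\vdash a=b\Rightarrow\ \vdash b=a$; $\vdash a=b,\ \vdash[v\mapsto a]p\Rightarrow\ \vdash[v\mapsto b]p$; $\vdash a\ne b\Rightarrow\ \vdash b\ne a$; $\vdash a\,\mathsf N,\ \vdash b\,\mathsf N\Rightarrow\ \vdash(a=b)\,\mathsf B$; $\vdash(a=b)\,\mathsf B\Rightarrow\ \vdash(a\,\mathsf N)\land(b\,\mathsf N)$; $\vdash\mathbf 0\,\mathsf N$; $\vdash a\,\mathsf N\Leftrightarrow\ \vdash(\mathbf S a)\,\mathsf N$; $\vdash a\,\mathsf N\Rightarrow\ \vdash\mathbf S a\ne\mathbf 0$; $\vdash a\ne b\Leftrightarrow\ \vdash\mathbf S a\ne\mathbf S b$; $\vdash\mathbf S a=\mathbf S b\Rightarrow\ \vdash a=b$; $\vdash\bot\,\mathsf N\Rightarrow\ \vdash p$; induction: $\vdash[v_i\mapsto\mathbf 0]c$, $\ v_i\,\mathsf N,c,\Gamma\vdash[v_i\mapsto\mathbf S v_i]c$, $\ \vdash a\,\mathsf N\Rightarrow\ \vdash[v_i\mapsto a]c$ if $v_i\notin\mathrm{fv}(\Gamma)$; conversion, for $c\triangleright c'$: $\vdash c'\Rightarrow\ \vdash c$; $\vdash c\Rightarrow\ \vdash c'$; $\vdash\neg c\Rightarrow\ \vdash\neg c'$; $\vdash c'\,\mathsf N\Rightarrow\ \vdash c=c'$; $\vdash m\,\mathsf N,\ \vdash(h\cdot m\cdot(\mathcal R\cdot g\cdot h\cdot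 m))\,\mathsf N\Rightarrow\ \vdash\mathcal R\cdot g\cdot h\cdot(\mathbf S m)=h\cdot m\cdot(\mathcal R\cdot g\cdot h\cdot m)$; $v_0\,\mathsf N,\uparrow\Gamma\vdash\uparrow f\cdot v_0\Rightarrow\Gamma\vdash\mathcal A\cdot f$; $\vdash\mathcal A\cdot f,\ \vdash a\,\mathsf N\Rightarrow\ \vdash f\cdot a$; $\vdash\neg(f\cdot a),\ \vdash a\,\mathsf N\Rightarrow\ \vdash\neg(\mathcal A\cdot f)$; $\Gamma\vdash\neg(\mathcal A\cdot f)$ and $v_0\,\mathsf N,\neg(\uparrow f\cdot v_0),\uparrow\Gamma\vdash\uparrow c\Rightarrow\Gamma\vdash c$. These are the rules of RGA. OGA has these and the rule ATI: $\Gamma\vdash\mathcal A\cdot(\lambda((\uparrow u\cdot v_0)\,\mathsf B))\Rightarrow\Gamma\vdash(\mathcal A\cdot u)\,\mathsf B$. Below $\vdash$ is OGA-derivability. **Search sentences.** A step function is a primitive recursive $f:\mathbb N^2\to\mathbb N$ presented by a primitive recursive definition (from zero, successor, projections by composition and primitive recursion); different definitions of the same function count as different step functions. Its search at $n$ hits at step $k$ if $f(n,k)\neq0$, and hits if it hits at some step. $\mathrm{cmp}(f)$ is the closed term obtained by compiling the definition into curried $\lambda$-terms: zero functions to $\lambda\cdots\lambda\,\mathbf 0$, successor to $\lambda\,\mathbf S v_0$, projections to $\lambda\cdots\lambda\,v_i$, composition to the corresponding applications, and $F(0,\vec x)=G(\vec x)$, $F(m+1,\vec x)=H(m,F(m,\vec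 x),\vec x)$ to the curried term sending $y,\vec x$ to $\mathcal R\cdot(\mathrm{cmp}(G)\cdot\vec x)\cdot(\lambda\lambda\,\mathrm{cmp}(H)\cdot v_1\cdot v_0\cdot\vec x)\cdot y$ (indices of $\vec x$ shifted under the $\lambda$s). Put $\mathrm{rrep}(f)=\lambda\,\neg(\mathcal A\cdot\lambda(\mathrm{cmp}(f)\cdot v_1\cdot v_0=\mathbf 0))$. $\mathrm{rrep}(f)\cdot\underline n$ expresses that the search of $f$ at $n$ hits, and $\mathcal A\cdot\mathrm{rrep}(f)$ that it hits at every $n$. **Fafi values and fictions.** A universal $\mathcal A\cdot u$ is certified if $\emptyset\vdash\mathcal A\cdot(\lambda((\uparrow u\cdot v_0)\,\mathsf B))$. For each certified $\mathcal A\cdot u$ there is an atom $x_{\mathcal A\cdot u}$. Values are elements of the free Boolean algebra on these atoms, with constants $\top$ and $\mathsf F$. Evaluation $\varphi\rightsquigarrow p$ ("$p$ is a value of $\varphi$") is the least relation with: $\varphi\rightsquigarrow\top$ if $\emptyset\vdash\varphi$; $\varphi\rightsquigarrow\mathsf F$ if $\emptyset\vdash\neg\varphi$; $\varphi\rightsquigarrow p$ implies $\neg\varphi\rightsquigarrow\neg p$; $\varphi\rightsquigarrow p$, $\psi\rightsquigarrow q$ imply $\varphi\lor\psi\rightsquigarrow p\lor q$; $\mathcal A\cdot u\rightsquigarrow x_{\mathcal A\cdot u}$ if $\mathcal A\cdot u$ is certified. A sentence $\varphi$ is a genuine fiction if it has a value and neither $\emptyset\vdash\varphi$ nor $\emptyset\vdash\neg\varphi$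 is derivable in OGA. -}

module Defs where

open import Algebra.Lattice.Bundles using (BooleanAlgebra)
open import Data.Bool using (if_then_else_)
open import Data.Fin using (Fin; toℕ; opposite)
open import Data.List using (List; []; _∷_; map)
open import Data.List.Relation.Binary.BagAndSetEquality using (_∼[_]_; set)
open import Data.List.Relation.Unary.All using (All)
open import Data.List.Relation.Unary.Any using (Any)
open import Data.Nat using (ℕ; zero; suc; _+_; _≡ᵇ_)
open import Data.Product using (_×_; _,_; ∃; ∃-syntax)
open import Data.Sum using (_⊎_)
open import Data.Empty using (⊥)
open import Data.Vec using (Vec; []; _∷_; lookup; tabulate; foldl)
open import Level using (0ℓ)
open import Relation.Binary.PropositionalEquality using (_≡_; _≢_)
open import Relation.Nullary using (¬_)

------------------------------------------------------------------------
-- Terms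

infixl 9 _·_ _·*_
infix  8 S_ _N _B
infix  7 _≐_ _≠_
infix  6 ~_
infixr 5 _∨_ _∧_
infix  4 ƛ_

data Term : Set where
  var  : ℕ → Term
  bot  : Term
  𝟎    : Term
  S_   : Term → Term
  _≐_  : Term → Term → Term
  ~_   : Term → Term
  _∨_  : Term → Term → Term
  ƛ_   : Term → Term
  _·_  : Term → Term → Term
  𝓡 𝓐 : Term

_N _B : Term → Term
t N = t ≐ t
t B = t ∨ ~ t

_≠_ _∧_ : Term → Term → Term
t ≠ u = ~ (t ≐ u)
t ∧ u = ~ (~ t ∨ ~ u)

num : ℕ → Term
num zero    = 𝟎
num (suc n) = S num n

ext : (ℕ → ℕ) → ℕ → ℕ
ext ρ zero    = zero
ext ρ (suc i) = suc (ρ i)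

rename : (ℕ → ℕ) → Term → Term
rename ρ (var i) = var (ρ i)
rename ρ bot     = bot
rename ρ 𝟎       = 𝟎
rename ρ (S t)   = S rename ρ t
rename ρ (t ≐ u) = rename ρ t ≐ rename ρ u
rename ρ (~ t)   = ~ rename ρ t
rename ρ (t ∨ u) = rename ρ t ∨ rename ρ u
rename ρ (ƛ t)   = ƛ rename (ext ρ) t
rename ρ (t · u) = rename ρ t · rename ρ u
rename ρ 𝓡       = 𝓡
rename ρ 𝓐       = 𝓐

↑ : Term → Term
↑ = rename suc

exts : (ℕ → Term) → ℕ → Term
exts σ zero    = var zero
exts σ (suc i) = ↑ (σ i)

subst : (ℕ → Term) → Term → Term
subst σ (var i) = σ i
subst σ bot     = bot
subst σ 𝟎       = 𝟎
subst σ (S t)   = S subst σ t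
subst σ (t ≐ u) = subst σ t ≐ subst σ u
subst σ (~ t)   = ~ subst σ t
subst σ (t ∨ u) = subst σ t ∨ subst σ u
subst σ (ƛ t)   = ƛ subst (exts σ) t
subst σ (t · u) = subst σ t · subst σ u
subst σ 𝓡       = 𝓡
subst σ 𝓐       = 𝓐

-- Unlike a β-instance, this leaves the indices of the other variables alone.
[_↦_] : ℕ → Term → Term → Term
[ v ↦ s ] = subst (λ i → if i ≡ᵇ v then s else var i)

instβ : Term → ℕ → Term
instβ t zero    = t
instβ t (suc i) = var i

_[_] : Term → Term → Term
b [ t ] = subst (instβ t) b

infix 4 _∈fv_

_∈fv_ : ℕ → Term → Set
i ∈fv var j   = i ≡ j
i ∈fv bot     = ⊥
i ∈fv 𝟎       = ⊥
i ∈fv (S t)   = i ∈fv t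
i ∈fv (t ≐ u) = i ∈fv t ⊎ i ∈fv u
i ∈fv (~ t)   = i ∈fv t
i ∈fv (t ∨ u) = i ∈fv t ⊎ i ∈fv u
i ∈fv (ƛ t)   = suc i ∈fv t
i ∈fv (t · u) = i ∈fv t ⊎ i ∈fv u
i ∈fv 𝓡       = ⊥
i ∈fv 𝓐       = ⊥

Closed : Term → Set
Closed t = ∀ i → ¬ (i ∈fv t)

infix 3 _▷_

data _▷_ : Term → Term → Set where
  β     : ∀ {b t} → (ƛ b) · t ▷ b [ t ]
  rec-0 : ∀ {g h} → 𝓡 · g · h · 𝟎 ▷ g
  rec-S : ∀ {g h} n → 𝓡 · g · h · (S num n) ▷ h · num n · (𝓡 · g · h · num n)
  app   : ∀ {t t′ u} → t ▷ t′ → t · u ▷ t′ · u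

------------------------------------------------------------------------
-- Judgments, rules, proofs

infix 2 _⊢_ _≋_

Context : Set
Context = List Term

data Judgment : Set where
  _⊢_ : Context → Term → Judgment

-- Contexts are finite sets: lists represent them, and judgments whose contexts
-- have the same elements are identified wherever a proof refers to an entry.
_≋_ : Judgment → Judgment → Set
(Γ ⊢ a) ≋ (Δ ⊢ b) = (Γ ∼[ set ] Δ) × a ≡ b

RuleSet : Set₁
RuleSet = List Judgment → Judgment → Set

data RGA : RuleSet where
  hyp  : ∀ {Γ c} → RGA [] (c ∷ Γ ⊢ c)
  weak : ∀ {Γ a c} → RGA ((Γ ⊢ c) ∷ []) (a ∷ Γ ⊢ c)
  cut  : ∀ {Γ a c} → RGA ((Γ ⊢ a) ∷ (a ∷ Γ ⊢ c) ∷ []) (Γ ⊢ c)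
  sub  : ∀ {Γ c} v s → RGA ((Γ ⊢ c) ∷ []) (map [ v ↦ s ] Γ ⊢ [ v ↦ s ] c)

  true⇒1  : ∀ {Γ a} → RGA ((Γ ⊢ a) ∷ []) (Γ ⊢ a ≐ num 1)
  1⇒true  : ∀ {Γ a} → RGA ((Γ ⊢ a ≐ num 1) ∷ []) (Γ ⊢ a)
  false⇒0 : ∀ {Γ a} → RGA ((Γ ⊢ ~ a) ∷ []) (Γ ⊢ a ≐ num 0)
  0⇒false : ∀ {Γ a} → RGA ((Γ ⊢ a ≐ num 0) ∷ []) (Γ ⊢ ~ a)

  explode : ∀ {Γ a c} → RGA ((Γ ⊢ ~ a) ∷ (Γ ⊢ a) ∷ []) (Γ ⊢ c)
  ~~-I    : ∀ {Γ a} → RGA ((Γ ⊢ a) ∷ []) (Γ ⊢ ~ (~ a))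
  ~~-E    : ∀ {Γ a} → RGA ((Γ ⊢ ~ (~ a)) ∷ []) (Γ ⊢ a)

  ∨-I₁  : ∀ {Γ a b} → RGA ((Γ ⊢ a) ∷ []) (Γ ⊢ a ∨ b)
  ∨-I₂  : ∀ {Γ a b} → RGA ((Γ ⊢ b) ∷ []) (Γ ⊢ a ∨ b)
  ~∨-I  : ∀ {Γ a b} → RGA ((Γ ⊢ ~ a) ∷ (Γ ⊢ ~ b) ∷ []) (Γ ⊢ ~ (a ∨ b))
  ∨-E   : ∀ {Γ a b c} →
          RGA ((Γ ⊢ a ∨ b) ∷ (a ∷ Γ ⊢ c) ∷ (b ∷ Γ ⊢ c) ∷ []) (Γ ⊢ c)
  ~∨-E₁ : ∀ {Γ a b} → RGA ((Γ ⊢ ~ (a ∨ b)) ∷ []) (Γ ⊢ ~ a)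
  ~∨-E₂ : ∀ {Γ a b} → RGA ((Γ ⊢ ~ (a ∨ b)) ∷ []) (Γ ⊢ ~ b)

  -- Trivial, since a N abbreviates a ≐ a.
  N⇒refl : ∀ {Γ a} → RGA ((Γ ⊢ a N) ∷ []) (Γ ⊢ a ≐ a)
  refl⇒N : ∀ {Γ a} → RGA ((Γ ⊢ a ≐ a) ∷ []) (Γ ⊢ a N)
  ≐-sym  : ∀ {Γ a b} → RGA ((Γ ⊢ a ≐ b) ∷ []) (Γ ⊢ b ≐ a)
  ≐-repl : ∀ {Γ a b} v p →
           RGA ((Γ ⊢ a ≐ b) ∷ (Γ ⊢ [ v ↦ a ] p) ∷ []) (Γ ⊢ [ v ↦ b ] p)
  ≠-sym  : ∀ {Γ a b} → RGA ((Γ ⊢ a ≠ b) ∷ []) (Γ ⊢ b ≠ a)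
  ≐-B    : ∀ {Γ a b} → RGA ((Γ ⊢ a N) ∷ (Γ ⊢ b N) ∷ []) (Γ ⊢ (a ≐ b) B)
  ≐-B⁻¹  : ∀ {Γ a b} → RGA ((Γ ⊢ (a ≐ b) B) ∷ []) (Γ ⊢ a N ∧ b N)

  0-N   : ∀ {Γ} → RGA [] (Γ ⊢ 𝟎 N)
  S-N   : ∀ {Γ a} → RGA ((Γ ⊢ a N) ∷ []) (Γ ⊢ (S a) N)
  S-N⁻¹ : ∀ {Γ a} → RGA ((Γ ⊢ (S a) N) ∷ []) (Γ ⊢ a N)
  S≠0   : ∀ {Γ a} → RGA ((Γ ⊢ a N) ∷ []) (Γ ⊢ S a ≠ 𝟎)
  S-≠   : ∀ {Γ a b} → RGA ((Γ ⊢ a ≠ b) ∷ []) (Γ ⊢ S a ≠ S b)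
  S-≠⁻¹ : ∀ {Γ a b} → RGA ((Γ ⊢ S a ≠ S b) ∷ []) (Γ ⊢ a ≠ b)
  S-inj : ∀ {Γ a b} → RGA ((Γ ⊢ S a ≐ S b) ∷ []) (Γ ⊢ a ≐ b)
  bot-E : ∀ {Γ p} → RGA ((Γ ⊢ bot N) ∷ []) (Γ ⊢ p)

  ind : ∀ {Γ a} i c → All (λ t → ¬ (i ∈fv t)) Γ →
        RGA ((Γ ⊢ [ i ↦ 𝟎 ] c) ∷
             (var i N ∷ c ∷ Γ ⊢ [ i ↦ S var i ] c) ∷
             (Γ ⊢ a N) ∷ [])
            (Γ ⊢ [ i ↦ a ] c)

  conv-exp : ∀ {Γ c c′} → c ▷ c′ → RGA ((Γ ⊢ c′) ∷ []) (Γ ⊢ c)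
  conv-red : ∀ {Γ c c′} → c ▷ c′ → RGA ((Γ ⊢ c) ∷ []) (Γ ⊢ c′)
  conv-~   : ∀ {Γ c c′} → c ▷ c′ → RGA ((Γ ⊢ ~ c) ∷ []) (Γ ⊢ ~ c′)
  conv-≐   : ∀ {Γ c c′} → c ▷ c′ → RGA ((Γ ⊢ c′ N) ∷ []) (Γ ⊢ c ≐ c′)

  rec-≐ : ∀ {Γ g h m} →
          RGA ((Γ ⊢ m N) ∷ (Γ ⊢ (h · m · (𝓡 · g · h · m)) N) ∷ [])
              (Γ ⊢ 𝓡 · g · h · (S m) ≐ h · m · (𝓡 · g · h · m))

  𝓐-I  : ∀ {Γ f} →
         RGA ((var 0 N ∷ map ↑ Γ ⊢ ↑ f · var 0) ∷ []) (Γ ⊢ 𝓐 · f)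
  𝓐-E  : ∀ {Γ f a} → RGA ((Γ ⊢ 𝓐 · f) ∷ (Γ ⊢ a N) ∷ []) (Γ ⊢ f · a)
  ~𝓐-I : ∀ {Γ f a} →
         RGA ((Γ ⊢ ~ (f · a)) ∷ (Γ ⊢ a N) ∷ []) (Γ ⊢ ~ (𝓐 · f))
  ~𝓐-E : ∀ {Γ f c} →
         RGA ((Γ ⊢ ~ (𝓐 · f)) ∷
              (var 0 N ∷ ~ (↑ f · var 0) ∷ map ↑ Γ ⊢ ↑ c) ∷ [])
             (Γ ⊢ c)

data OGA : RuleSet where
  rga : ∀ {ps j} → RGA ps j → OGA ps j
  ATI : ∀ {Γ u} →
        OGA ((Γ ⊢ 𝓐 · (ƛ (↑ u · var 0) B)) ∷ []) (Γ ⊢ (𝓐 · u) B)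

infixr 5 _∷⟨_⟩_

-- Proofs are listed with the latest judgment first.
data Proof (R : RuleSet) : List Judgment → Set where
  []     : Proof R []
  _∷⟨_⟩_ : ∀ {ps j π} →
           R ps j → All (λ p → Any (p ≋_) π) ps → Proof R π → Proof R (j ∷ π)

Derivable : RuleSet → Judgment → Set
Derivable R j = ∃[ π ] (Proof R π × Any (j ≋_) π)

infix 2 _⊢ᴼ_

_⊢ᴼ_ : Context → Term → Set
Γ ⊢ᴼ c = Derivable OGA (Γ ⊢ c)

------------------------------------------------------------------------
-- Primitive recursive definitions and search sentences

data PR : ℕ → Set where
  zer  : ∀ {n} → PR n
  succ : PR 1
  proj : ∀ {n} → Fin n → PR n
  comp : ∀ {m n} → PR m → Vec (PR n) m → PR n
  prec : ∀ {n} → PR n → PR (2 + n) → PR (suc n)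

mutual
  eval : ∀ {n} → PR n → Vec ℕ n → ℕ
  eval zer         xs       = 0
  eval succ        (x ∷ []) = suc x
  eval (proj i)    xs       = lookup xs i
  eval (comp h gs) xs       = eval h (evals gs xs)
  eval (prec g h)  (y ∷ xs) = evalRec g h y xs

  evals : ∀ {m n} → Vec (PR n) m → Vec ℕ n → Vec ℕ m
  evals []       xs = []
  evals (g ∷ gs) xs = eval g xs ∷ evals gs xs

  evalRec : ∀ {n} → PR n → PR (2 + n) → ℕ → Vec ℕ n → ℕ
  evalRec g h zero    xs = eval g xs
  evalRec g h (suc m) xs = eval h (m ∷ evalRec g h m xs ∷ xs)

-- The presentation, not the function it computes.
StepFunction : Set
StepFunction = PR 2

HitsAtStep : StepFunction → ℕ → ℕ → Set
HitsAtStep f n k = eval f (n ∷ k ∷ []) ≢ 0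

Hits : StepFunction → ℕ → Set
Hits f n = ∃[ k ] HitsAtStep f n k

lams : ℕ → Term → Term
lams zero    t = t
lams (suc n) t = ƛ lams n t

_·*_ : ∀ {n} → Term → Vec Term n → Term
t ·* us = foldl (λ _ → Term) _·_ t us

-- The arguments x₁,…,xₙ bound by n abstractions, seen under k further ones:
-- the first argument has the highest index, n - 1 + k.
args : ∀ k n → Vec Term n
args k n = tabulate (λ i → var (k + toℕ (opposite i)))

-- Compiled terms are closed, so they are placed under abstractions unshifted.
mutual
  cmp : ∀ {n} → PR n → Term
  cmp {n} zer         = lams n 𝟎
  cmp     succ        = ƛ S var 0
  cmp {n} (proj i)    = lams n (lookup (args 0 n) i)
  cmp {n} (comp h gs) = lams n (cmp h ·* cmpArgs gs)
  cmp (prec {n} g h)  =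
    lams (suc n)
      (𝓡 · (cmp g ·* args 0 n)
         · (ƛ ƛ cmp h · var 1 · var 0 ·* args 2 n)
         · var n)

  cmpArgs : ∀ {m n} → Vec (PR n) m → Vec Term m
  cmpArgs         []       = []
  cmpArgs {n = n} (g ∷ gs) = (cmp g ·* args 0 n) ∷ cmpArgs gs

rrep : StepFunction → Term
rrep f = ƛ ~ (𝓐 · (ƛ cmp f · var 1 · var 0 ≐ 𝟎))

------------------------------------------------------------------------
-- Free Boolean algebras

infix  8 ¬ᵛ_
infixr 7 _∧ᵛ_
infixr 6 _∨ᵛ_
infix  4 _≈ᵛ_

data Expr (X : Set) : Set where
  atom      : X → Expr X
  ⊤ᵛ 𝖥      : Expr X
  ¬ᵛ_       : Expr X → Expr X
  _∨ᵛ_ _∧ᵛ_ : Expr X → Expr X → Expr X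

-- Elements of the free Boolean algebra on X are expressions up to the
-- congruence generated by the axioms of Boolean algebras.
data _≈ᵛ_ {X : Set} : Expr X → Expr X → Set where
  reflᵛ  : ∀ {p} → p ≈ᵛ p
  symᵛ   : ∀ {p q} → p ≈ᵛ q → q ≈ᵛ p
  transᵛ : ∀ {p q r} → p ≈ᵛ q → q ≈ᵛ r → p ≈ᵛ r
  ¬-cong : ∀ {p q} → p ≈ᵛ q → ¬ᵛ p ≈ᵛ ¬ᵛ q
  ∨-cong : ∀ {p p′ q q′} → p ≈ᵛ p′ → q ≈ᵛ q′ → p ∨ᵛ q ≈ᵛ p′ ∨ᵛ q′
  ∧-cong : ∀ {p p′ q q′} → p ≈ᵛ p′ → q ≈ᵛ q′ → p ∧ᵛ q ≈ᵛ p′ ∧ᵛ q′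
  ∨-comm  : ∀ p q → p ∨ᵛ q ≈ᵛ q ∨ᵛ p
  ∧-comm  : ∀ p q → p ∧ᵛ q ≈ᵛ q ∧ᵛ p
  ∨-assoc : ∀ p q r → (p ∨ᵛ q) ∨ᵛ r ≈ᵛ p ∨ᵛ (q ∨ᵛ r)
  ∧-assoc : ∀ p q r → (p ∧ᵛ q) ∧ᵛ r ≈ᵛ p ∧ᵛ (q ∧ᵛ r)
  ∨-absorbs-∧ : ∀ p q → p ∨ᵛ (p ∧ᵛ q) ≈ᵛ p
  ∧-absorbs-∨ : ∀ p q → p ∧ᵛ (p ∨ᵛ q) ≈ᵛ p
  ∨-distribˡ-∧ : ∀ p q r → p ∨ᵛ (q ∧ᵛ r) ≈ᵛ (p ∨ᵛ q) ∧ᵛ (p ∨ᵛ r)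
  ∧-distribˡ-∨ : ∀ p q r → p ∧ᵛ (q ∨ᵛ r) ≈ᵛ (p ∧ᵛ q) ∨ᵛ (p ∧ᵛ r)
  ∨-complementʳ : ∀ p → p ∨ᵛ ¬ᵛ p ≈ᵛ ⊤ᵛ
  ∧-complementʳ : ∀ p → p ∧ᵛ ¬ᵛ p ≈ᵛ 𝖥

freeBooleanAlgebra : Set → BooleanAlgebra 0ℓ 0ℓ
freeBooleanAlgebra X = record
  { Carrier = Expr X
  ; _≈_     = _≈ᵛ_
  ; _∨_     = _∨ᵛ_
  ; _∧_     = _∧ᵛ_
  ; ¬_      = ¬ᵛ_
  ; ⊤       = ⊤ᵛ
  ; ⊥       = 𝖥
  ; isBooleanAlgebra = record
    { isDistributiveLattice = record
      { isLattice = record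
        { isEquivalence = record { refl = reflᵛ ; sym = symᵛ ; trans = transᵛ }
        ; ∨-comm     = ∨-comm
        ; ∨-assoc    = ∨-assoc
        ; ∨-cong     = ∨-cong
        ; ∧-comm     = ∧-comm
        ; ∧-assoc    = ∧-assoc
        ; ∧-cong     = ∧-cong
        ; absorptive = ∨-absorbs-∧ , ∧-absorbs-∨
        }
      ; ∨-distrib-∧ = ∨-distribˡ-∧ , λ p q r →
          transᵛ (∨-comm _ _) (transᵛ (∨-distribˡ-∧ p q r)
            (∧-cong (∨-comm _ _) (∨-comm _ _)))
      ; ∧-distrib-∨ = ∧-distribˡ-∨ , λ p q r →
          transᵛ (∧-comm _ _) (transᵛ (∧-distribˡ-∨ p q r)
            (∨-cong (∧-comm _ _) (∧-comm _ _)))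
      }
    ; ∨-complement = (λ p → transᵛ (∨-comm _ _) (∨-complementʳ p)) , ∨-complementʳ
    ; ∧-complement = (λ p → transᵛ (∧-comm _ _) (∧-complementʳ p)) , ∧-complementʳ
    ; ¬-cong       = ¬-cong
    }
  }

------------------------------------------------------------------------
-- Fafi values and fictions

Certified : Term → Set
Certified u = [] ⊢ᴼ 𝓐 · (ƛ (↑ u · var 0) B)

-- The certificate is irrelevant: each certified universal has a single atom,
-- however many derivations certify it.
record Atom : Set where
  constructor mkAtom
  field
    body       : Term
    .certified : Certified body

Value : Set
Value = BooleanAlgebra.Carrier (freeBooleanAlgebra Atom)

infix 2 _⇝_

data _⇝_ : Term → Value → Set where
  prov : ∀ {φ} → [] ⊢ᴼ φ → φ ⇝ ⊤ᵛ
  refu : ∀ {φ} → [] ⊢ᴼ ~ φ → φ ⇝ 𝖥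
  neg  : ∀ {φ p} → φ ⇝ p → ~ φ ⇝ ¬ᵛ p
  disj : ∀ {φ ψ p q} → φ ⇝ p → ψ ⇝ q → φ ∨ ψ ⇝ p ∨ᵛ q
  univ : ∀ {u} (cert : Certified u) → 𝓐 · u ⇝ atom (mkAtom u cert)
  -- Values are elements of the algebra rather than expressions.
  resp : ∀ {φ p q} → p ≈ᵛ q → φ ⇝ p → φ ⇝ q

-- A sentence is a closed term.
GenuineFiction : Term → Set
GenuineFiction φ =
  Closed φ × (∃[ p ] (φ ⇝ p)) × ¬ ([] ⊢ᴼ φ) × ¬ ([] ⊢ᴼ ~ φ)

{-# OPTIONS --safe #-}
module Submission where

-- The core is that ~ G is unprovable, by soundness: terms denote numbers
-- (truth values being 0 and 1), and the denotation relation is built in stages,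
-- 𝓐 ranging over all numerals. Classically ATI is sound for the least fixed point
-- of the stage operator Φ, but its proof needs the limited principle of omniscience.
-- Constructively, only double negations of denotations are kept, and no fixed point
-- is reached; instead a proof sends each stage at which the context holds to a stage
-- at which the conclusion holds, uniformly in the substituted terms, so that no double
-- negation ever has to be moved across a quantifier. As all searches hit, G cannot
-- denote 0 at any stage. Excluded middle for G follows from ATI, used at both
-- quantifiers, since compiled functions are provably total.

open import Defs
open import Data.Bool using (true; false; if_then_else_; T)
open import Data.Empty using (⊥; ⊥-elim)
open import Data.Fin using (zero; suc; toℕ; opposite)
open import Data.Fin.Properties using (toℕ<n; toℕ-fromℕ; toℕ-inject₁)
open import Data.List using ([]; _∷_; _++_; map)
open import Data.List.Relation.Unary.All as All using (All; []; _∷_)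
open import Data.List.Relation.Unary.All.Properties using (map⁺; map⁻)
open import Data.List.Relation.Unary.Any using (Any; here; there)
open import Data.List.Relation.Unary.Any.Properties using (++⁺ˡ; ++⁺ʳ)
open import Data.Nat using (ℕ; zero; suc; _+_; _≤_; _<_; _≡ᵇ_; _≟_)
open import Data.Nat.ListAction using (sum)
open import Data.Nat.Properties
  using (≡ᵇ⇒≡; ≡⇒≡ᵇ; suc-injective; +-suc; +-identityʳ; +-assoc; +-cancelˡ-≡;
         m≤m+n; m≤n+m; ≤-refl; ≤-trans; <⇒≤; <-≤-trans; <-irrefl; <⇒≢)
open import Data.Product using (_×_; _,_; proj₁; proj₂; ∃-syntax)
open import Data.Sum using (_⊎_; inj₁; inj₂)
open import Data.Vec as Vec using (Vec; []; _∷_; lookup; tabulate)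
open import Data.Vec.Properties
  using (tabulate-∘; tabulate-cong; tabulate∘lookup; lookup-map; map-∘; map-cong; map-id)
open import Data.Vec.Relation.Binary.Pointwise.Inductive as Pointwise using (Pointwise; []; _∷_)
open import Data.Vec.Relation.Unary.All as VecAll using ([]; _∷_)
open import Data.Vec.Relation.Unary.All.Properties using (lookup⁺; tabulate⁺)
open import Function using (_∘_; id; case_of_)
open import Function.Bundles using (Equivalence; mk⇔)
open import Relation.Binary.Construct.Closure.ReflexiveTransitive using (Star; ε; _◅_)
open import Relation.Binary.PropositionalEquality
  using (_≡_; _≢_; refl; sym; trans; cong; cong₂)
  renaming (subst to transport)
open import Relation.Nullary using (¬_; yes; no)
open import Relation.Nullary.Decidable.Core using (¬¬-excluded-middle)

-- Substitution calculus

subst-cong-fv : ∀ {σ τ} t → (∀ {i} → i ∈fv t → σ i ≡ τ i) → subst σ t ≡ subst τ t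
subst-cong-fv (var i) h = h refl
subst-cong-fv bot     h = refl
subst-cong-fv 𝟎       h = refl
subst-cong-fv (S t)   h = cong S_ (subst-cong-fv t h)
subst-cong-fv (t ≐ u) h = cong₂ _≐_ (subst-cong-fv t (h ∘ inj₁)) (subst-cong-fv u (h ∘ inj₂))
subst-cong-fv (~ t)   h = cong ~_ (subst-cong-fv t h)
subst-cong-fv (t ∨ u) h = cong₂ _∨_ (subst-cong-fv t (h ∘ inj₁)) (subst-cong-fv u (h ∘ inj₂))
subst-cong-fv {σ} {τ} (ƛ t) h = cong ƛ_ (subst-cong-fv t λ {i} → under i)
  where
  under : ∀ i → i ∈fv t → exts σ i ≡ exts τ i
  under zero    _ = refl
  under (suc i) p = cong ↑ (h p)
subst-cong-fv (t · u) h = cong₂ _·_ (subst-cong-fv t (h ∘ inj₁)) (subst-cong-fv u (h ∘ inj₂))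
subst-cong-fv 𝓡       h = refl
subst-cong-fv 𝓐       h = refl

subst-cong : ∀ {σ τ} → (∀ i → σ i ≡ τ i) → ∀ t → subst σ t ≡ subst τ t
subst-cong h t = subst-cong-fv t λ {i} _ → h i

subst-var : ∀ {σ} → (∀ i → σ i ≡ var i) → ∀ t → subst σ t ≡ t
subst-var h (var i) = h i
subst-var h bot     = refl
subst-var h 𝟎       = refl
subst-var h (S t)   = cong S_ (subst-var h t)
subst-var h (t ≐ u) = cong₂ _≐_ (subst-var h t) (subst-var h u)
subst-var h (~ t)   = cong ~_ (subst-var h t)
subst-var h (t ∨ u) = cong₂ _∨_ (subst-var h t) (subst-var h u)
subst-var h (ƛ t)   = cong ƛ_ (subst-var (λ where
  zero    → refl
  (suc i) → cong ↑ (h i)) t)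
subst-var h (t · u) = cong₂ _·_ (subst-var h t) (subst-var h u)
subst-var h 𝓡       = refl
subst-var h 𝓐       = refl

rename-as-subst : ∀ ρ t → rename ρ t ≡ subst (var ∘ ρ) t
rename-as-subst ρ (var i) = refl
rename-as-subst ρ bot     = refl
rename-as-subst ρ 𝟎       = refl
rename-as-subst ρ (S t)   = cong S_ (rename-as-subst ρ t)
rename-as-subst ρ (t ≐ u) = cong₂ _≐_ (rename-as-subst ρ t) (rename-as-subst ρ u)
rename-as-subst ρ (~ t)   = cong ~_ (rename-as-subst ρ t)
rename-as-subst ρ (t ∨ u) = cong₂ _∨_ (rename-as-subst ρ t) (rename-as-subst ρ u)
rename-as-subst ρ (ƛ t)   = cong ƛ_ (trans (rename-as-subst (ext ρ) t)
  (subst-cong (λ where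
    zero    → refl
    (suc i) → refl) t))
rename-as-subst ρ (t · u) = cong₂ _·_ (rename-as-subst ρ t) (rename-as-subst ρ u)
rename-as-subst ρ 𝓡       = refl
rename-as-subst ρ 𝓐       = refl

subst-rename : ∀ {ρ σ τ} → (∀ i → σ (ρ i) ≡ τ i) →
               ∀ t → subst σ (rename ρ t) ≡ subst τ t
subst-rename h (var i) = h i
subst-rename h bot     = refl
subst-rename h 𝟎       = refl
subst-rename h (S t)   = cong S_ (subst-rename h t)
subst-rename h (t ≐ u) = cong₂ _≐_ (subst-rename h t) (subst-rename h u)
subst-rename h (~ t)   = cong ~_ (subst-rename h t)
subst-rename h (t ∨ u) = cong₂ _∨_ (subst-rename h t) (subst-rename h u)
subst-rename h (ƛ t)   = cong ƛ_ (subst-rename (λ where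
  zero    → refl
  (suc i) → cong ↑ (h i)) t)
subst-rename h (t · u) = cong₂ _·_ (subst-rename h t) (subst-rename h u)
subst-rename h 𝓡       = refl
subst-rename h 𝓐       = refl

rename-rename : ∀ {ρ ρ′ ρ″} → (∀ i → ρ (ρ′ i) ≡ ρ″ i) →
                ∀ t → rename ρ (rename ρ′ t) ≡ rename ρ″ t
rename-rename h t =
  trans (rename-as-subst _ (rename _ t))
    (trans (subst-rename (cong var ∘ h) t) (sym (rename-as-subst _ t)))

rename-subst : ∀ {ρ σ τ} → (∀ i → rename ρ (σ i) ≡ τ i) →
               ∀ t → rename ρ (subst σ t) ≡ subst τ t
rename-subst h (var i) = h i
rename-subst h bot     = refl
rename-subst h 𝟎       = refl
rename-subst h (S t)   = cong S_ (rename-subst h t)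
rename-subst h (t ≐ u) = cong₂ _≐_ (rename-subst h t) (rename-subst h u)
rename-subst h (~ t)   = cong ~_ (rename-subst h t)
rename-subst h (t ∨ u) = cong₂ _∨_ (rename-subst h t) (rename-subst h u)
rename-subst {σ = σ} h (ƛ t) = cong ƛ_ (rename-subst (λ where
  zero    → refl
  (suc i) → trans (rename-rename (λ _ → refl) (σ i))
              (trans (sym (rename-rename (λ _ → refl) (σ i))) (cong ↑ (h i)))) t)
rename-subst h (t · u) = cong₂ _·_ (rename-subst h t) (rename-subst h u)
rename-subst h 𝓡       = refl
rename-subst h 𝓐       = refl

-- The binder case of fusion, where substitution after renaming and renaming after substitution meet
-- at `↑`.
exts-∘ : ∀ {σ τ υ} → (∀ i → subst τ (σ i) ≡ υ i) →
         ∀ i → subst (exts τ) (exts σ i) ≡ exts υ i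
exts-∘     h zero    = refl
exts-∘ {σ} h (suc i) =
  trans (subst-rename (λ _ → refl) (σ i))
    (trans (sym (rename-subst (λ _ → refl) (σ i))) (cong ↑ (h i)))

subst-subst : ∀ {σ τ υ} → (∀ i → subst τ (σ i) ≡ υ i) →
              ∀ t → subst τ (subst σ t) ≡ subst υ t
subst-subst h (var i) = h i
subst-subst h bot     = refl
subst-subst h 𝟎       = refl
subst-subst h (S t)   = cong S_ (subst-subst h t)
subst-subst h (t ≐ u) = cong₂ _≐_ (subst-subst h t) (subst-subst h u)
subst-subst h (~ t)   = cong ~_ (subst-subst h t)
subst-subst h (t ∨ u) = cong₂ _∨_ (subst-subst h t) (subst-subst h u)
subst-subst h (ƛ t) = cong ƛ_ (subst-subst (exts-∘ h) t)
subst-subst h (t · u) = cong₂ _·_ (subst-subst h t) (subst-subst h u)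
subst-subst h 𝓡       = refl
subst-subst h 𝓐       = refl

subst-num : ∀ σ n → subst σ (num n) ≡ num n
subst-num σ zero    = refl
subst-num σ (suc n) = cong S_ (subst-num σ n)

subst-closed : ∀ {σ t} → Closed t → subst σ t ≡ t
subst-closed {σ} {t} c =
  trans (subst-cong-fv t λ {i} p → ⊥-elim (c i p)) (subst-var (λ _ → refl) t)

rename-closed : ∀ {ρ t} → Closed t → rename ρ t ≡ t
rename-closed {ρ} {t} c = trans (rename-as-subst ρ t) (subst-closed c)

infixr 5 _•_

_•_ : Term → (ℕ → Term) → ℕ → Term
(u • σ) zero    = u
(u • σ) (suc i) = σ i

instβ-↑ : ∀ u t → subst (instβ u) (↑ t) ≡ t
instβ-↑ u t = trans (subst-rename (λ _ → refl) t) (subst-var (λ _ → refl) t)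

instβ-exts : ∀ {σ} u i → subst (instβ u) (exts σ i) ≡ (u • σ) i
instβ-exts     u zero    = refl
instβ-exts {σ} u (suc i) = instβ-↑ u (σ i)

subst-exts-[] : ∀ {σ} b u → subst (exts σ) b [ u ] ≡ subst (u • σ) b
subst-exts-[] b u = subst-subst (instβ-exts u) b

subst-[] : ∀ {σ} b t → subst σ (b [ t ]) ≡ subst (exts σ) b [ subst σ t ]
subst-[] {σ} b t = trans
  (subst-subst (λ where
    zero    → refl
    (suc i) → refl) b)
  (sym (subst-exts-[] b (subst σ t)))

subst-• : ∀ {σ} u t → subst (u • σ) (↑ t) ≡ subst σ t
subst-• u t = subst-rename (λ _ → refl) t

infixl 10 _[_≔_]

-- Semantic counterpart of `[_↦_]`: the other indices stay in place, whereas `_•_` shifts them.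
_[_≔_] : (ℕ → Term) → ℕ → Term → ℕ → Term
(σ [ i ≔ u ]) j = if j ≡ᵇ i then u else σ j

subst-↦ : ∀ {σ} i a c → subst σ ([ i ↦ a ] c) ≡ subst (σ [ i ≔ subst σ a ]) c
subst-↦ {σ} i a = subst-subst pointwise
  where
  pointwise : ∀ j → subst σ (if j ≡ᵇ i then a else var j) ≡ (σ [ i ≔ subst σ a ]) j
  pointwise j with j ≡ᵇ i
  ... | true  = refl
  ... | false = refl

≔-self : ∀ σ i u → (σ [ i ≔ u ]) i ≡ u
≔-self σ i u with i ≡ᵇ i | ≡⇒≡ᵇ i i refl
... | true | _ = refl

≔-overwrite : ∀ σ i u w j → (σ [ i ≔ u ] [ i ≔ w ]) j ≡ (σ [ i ≔ w ]) j
≔-overwrite σ i u w j with j ≡ᵇ i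
... | true  = refl
... | false = refl

≔-fresh : ∀ {σ i u} t → ¬ (i ∈fv t) → subst (σ [ i ≔ u ]) t ≡ subst σ t
≔-fresh {σ} {i} {u} t i∉ = subst-cong-fv t λ {j} j∈ → lemma j j∈
  where
  lemma : ∀ j → j ∈fv t → (σ [ i ≔ u ]) j ≡ σ j
  lemma j j∈ with j ≡ᵇ i in eq
  ... | false = refl
  ... | true  with ≡ᵇ⇒≡ j i (transport T (sym eq) _)
  ...   | refl = ⊥-elim (i∉ j∈)

↦-fresh : ∀ {i u} t → ¬ (i ∈fv t) → [ i ↦ u ] t ≡ t
↦-fresh t i∉ = trans (≔-fresh {σ = var} t i∉) (subst-var (λ _ → refl) t)

-- Denotations by levels

-- Countably branching trees index the stages. Successors, joins and `ω` are all instances of `lim`,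
-- compared only through inclusions of denotations.
data Ord : Set where
  zero : Ord
  lim  : (ℕ → Ord) → Ord

module _ (D : Term → ℕ → Set) where

  -- Head reduction, except that the recursor inspects the value of its argument instead of its
  -- shape; otherwise exchanging subterms of equal value could block it.
  data Step : Term → Term → Set where
    β     : ∀ {b t} → Step ((ƛ b) · t) (b [ t ])
    rec-0 : ∀ {g h t} → D t 0 → Step (𝓡 · g · h · t) g
    rec-S : ∀ {g h t} n → D t (suc n) →
            Step (𝓡 · g · h · t) (h · num n · (𝓡 · g · h · num n))
    app   : ∀ {t t′ u} → Step t t′ → Step (t · u) (t′ · u)

  data Φ : Term → ℕ → Set where
    nil   : Φ 𝟎 0
    next  : ∀ {t n} → D t n → Φ (S t) (suc n)
    equal : ∀ {t u n} → D t n → D u n → Φ (t ≐ u) 1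
    apart : ∀ {t u m n} → D t m → D u n → m ≢ n → Φ (t ≐ u) 0
    neg-1   : ∀ {t} → D t 0 → Φ (~ t) 1
    neg-0   : ∀ {t} → D t 1 → Φ (~ t) 0
    or-1₁  : ∀ {t u} → D t 1 → Φ (t ∨ u) 1
    or-1₂  : ∀ {t u} → D u 1 → Φ (t ∨ u) 1
    or-0   : ∀ {t u} → D t 0 → D u 0 → Φ (t ∨ u) 0
    all-1   : ∀ {u} → (∀ n → D (u · num n) 1) → Φ (𝓐 · u) 1
    all-0   : ∀ {u} n → D (u · num n) 0 → Φ (𝓐 · u) 0
    step  : ∀ {t t′ n} → Step t t′ → D t′ n → Φ t n

opaque
  -- The double negations make LEM, hence ATI, valid at every level.
  D : Ord → Term → ℕ → Set
  D zero    t n = ⊥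
  D (lim s) t n = ¬ ¬ (∃[ i ] Φ (D (s i)) t n)

  D-stable : ∀ a {t n} → ¬ ¬ D a t n → D a t n
  D-stable zero    k = k id
  D-stable (lim s) k = λ ¬x → k λ d → d ¬x

infixl 1 _>>=_

-- Denotations are stable, so a doubly negated fact may be used whenever the goal is a denotation.
_>>=_ : ∀ {A : Set} {a t n} → ¬ ¬ A → (A → D a t n) → D a t n
_>>=_ {a = a} x f = D-stable a λ ¬d → x (¬d ∘ f)

module _ {D E : Term → ℕ → Set} (D⊆E : ∀ {t n} → D t n → E t n) where

  Step-mono : ∀ {t u} → Step D t u → Step E t u
  Step-mono β           = β
  Step-mono (rec-0 d)   = rec-0 (D⊆E d)
  Step-mono (rec-S n d) = rec-S n (D⊆E d)
  Step-mono (app s)     = app (Step-mono s)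

  Φ-mono : ∀ {t n} → Φ D t n → Φ E t n
  Φ-mono nil            = nil
  Φ-mono (next d)       = next (D⊆E d)
  Φ-mono (equal d e)    = equal (D⊆E d) (D⊆E e)
  Φ-mono (apart d e ne) = apart (D⊆E d) (D⊆E e) ne
  Φ-mono (neg-1 d)        = neg-1 (D⊆E d)
  Φ-mono (neg-0 d)        = neg-0 (D⊆E d)
  Φ-mono (or-1₁ d)       = or-1₁ (D⊆E d)
  Φ-mono (or-1₂ d)       = or-1₂ (D⊆E d)
  Φ-mono (or-0 d e)      = or-0 (D⊆E d) (D⊆E e)
  Φ-mono (all-1 d)        = all-1 (D⊆E ∘ d)
  Φ-mono (all-0 n d)      = all-0 n (D⊆E d)
  Φ-mono (step s d)     = step (Step-mono s) (D⊆E d)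

opaque
  unfolding D

  mutual
    -- The branch that produced the value is forgotten: by monotonicity its parts denote at `a`
    -- itself, so inversion keeps the level.
    D-inv : ∀ a {t n} → D a t n → ¬ ¬ Φ (D a) t n
    D-inv (lim s) d ¬φ = d λ (i , φ) → ¬φ (Φ-mono (D-lim s i) φ)

    D-lim : ∀ s i {t n} → D (s i) t n → D (lim s) t n
    D-lim s i d ¬φ = D-inv (s i) d λ φ → ¬φ (i , φ)

module _ {D E : Term → ℕ → Set} (det : ∀ {t m n} → D t m → E t n → m ≡ n) where

  -- Two relations are involved because denotations at different levels get compared. Rules do not
  -- overlap, as no proper prefix of a redex can step.
  Step-det : ∀ {t u v} → Step D t u → Step E t v → u ≡ v
  Step-det β           β           = refl
  Step-det β           (app ())
  Step-det (rec-0 d)   (rec-0 e)   = refl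
  Step-det (rec-0 d)   (rec-S n e) with () ← det d e
  Step-det (rec-0 d)   (app (app (app ())))
  Step-det (rec-S m d) (rec-0 e)   with () ← det d e
  Step-det (rec-S m d) (rec-S n e) with refl ← det d e = refl
  Step-det (rec-S m d) (app (app (app ())))
  Step-det (app ())    β
  Step-det (app (app (app ()))) (rec-0 e)
  Step-det (app (app (app ()))) (rec-S n e)
  Step-det (app s)     (app s′)    = cong (_· _) (Step-det s s′)

  Φ-det : ∀ {t m n} → Φ D t m → Φ E t n → m ≡ n
  Φ-det nil            nil            = refl
  Φ-det (next d)       (next e)        = cong suc (det d e)
  Φ-det (equal d d′)   (equal e e′)   = refl
  Φ-det (equal d d′)   (apart e e′ ne) = ⊥-elim (ne (trans (sym (det d e)) (det d′ e′)))
  Φ-det (apart d d′ ne) (equal e e′)  = ⊥-elim (ne (trans (det d e) (sym (det d′ e′))))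
  Φ-det (apart d d′ _) (apart e e′ _) = refl
  Φ-det (neg-1 d)        (neg-1 e)        = refl
  Φ-det (neg-1 d)        (neg-0 e)        with () ← det d e
  Φ-det (neg-0 d)        (neg-1 e)        with () ← det d e
  Φ-det (neg-0 d)        (neg-0 e)        = refl
  Φ-det (or-1₁ d)       (or-1₁ e)       = refl
  Φ-det (or-1₁ d)       (or-1₂ e)       = refl
  Φ-det (or-1₁ d)       (or-0 e _)      with () ← det d e
  Φ-det (or-1₂ d)       (or-1₁ e)       = refl
  Φ-det (or-1₂ d)       (or-1₂ e)       = refl
  Φ-det (or-1₂ d)       (or-0 _ e)      with () ← det d e
  Φ-det (or-0 d _)      (or-1₁ e)       with () ← det d e
  Φ-det (or-0 _ d)      (or-1₂ e)       with () ← det d e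
  Φ-det (or-0 _ _)      (or-0 _ _)      = refl
  Φ-det (all-1 d)        (all-1 e)        = refl
  Φ-det (all-1 d)        (all-0 n e)      with () ← det (d n) e
  Φ-det (all-1 d)        (step (app ()) _)
  Φ-det (all-0 n d)      (all-1 e)        with () ← det d (e n)
  Φ-det (all-0 _ d)      (all-0 _ e)      = refl
  Φ-det (all-0 _ d)      (step (app ()) _)
  Φ-det (step (app ()) _) (all-1 _)
  Φ-det (step (app ()) _) (all-0 _ _)
  Φ-det (step s d)     (step s′ e)    with refl ← Step-det s s′ = det d e

opaque
  unfolding D

  -- Equality of numbers is decidable, so it suffices to refute `m ≢ n`, and there both double
  -- negations can be opened.
  D-det : ∀ a b {t m n} → D a t m → D b t n → m ≡ n
  D-det (lim s) (lim s′) {m = m} {n} d e with m ≟ n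
  ... | yes eq = eq
  ... | no  ne = ⊥-elim (d λ (i , φ) → e λ (j , ψ) → ne (Φ-det (D-det (s i) (s′ j)) φ ψ))

module _ {D : Term → ℕ → Set} (D-sub : ∀ {σ t n} → D t n → D (subst σ t) n) where

  Step-subst : ∀ {σ t u} → Step D t u → Step D (subst σ t) (subst σ u)
  Step-subst {σ} (β {b} {t}) rewrite subst-[] {σ} b t = β
  Step-subst (rec-0 d) = rec-0 (D-sub d)
  Step-subst {σ} (rec-S n d) rewrite subst-num σ n = rec-S n (D-sub d)
  Step-subst (app s) = app (Step-subst s)

  Φ-subst : ∀ {σ t n} → Φ D t n → Φ D (subst σ t) n
  Φ-subst nil            = nil
  Φ-subst (next d)       = next (D-sub d)
  Φ-subst (equal d e)    = equal (D-sub d) (D-sub e)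
  Φ-subst (apart d e ne) = apart (D-sub d) (D-sub e) ne
  Φ-subst (neg-1 d)        = neg-1 (D-sub d)
  Φ-subst (neg-0 d)        = neg-0 (D-sub d)
  Φ-subst (or-1₁ d)       = or-1₁ (D-sub d)
  Φ-subst (or-1₂ d)       = or-1₂ (D-sub d)
  Φ-subst (or-0 d e)      = or-0 (D-sub d) (D-sub e)
  Φ-subst {σ} (all-1 {u} d) = all-1 λ n →
    transport (λ k → D (subst σ u · k) 1) (subst-num σ n) (D-sub (d n))
  Φ-subst {σ} (all-0 {u} n d) = all-0 n
    (transport (λ k → D (subst σ u · k) 0) (subst-num σ n) (D-sub d))
  Φ-subst (step s d)     = step (Step-subst s) (D-sub d)

opaque
  unfolding D

  -- No rule of `Φ` looks at a variable, so a derivation for an open term serves all its instances,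
  -- at the same level.
  D-subst : ∀ a {σ t n} → D a t n → D a (subst σ t) n
  D-subst (lim s) d ¬φ = d λ (i , φ) → ¬φ (i , Φ-subst (D-subst (s i)) φ)

D-rename : ∀ a {ρ t n} → D a t n → D a (rename ρ t) n
D-rename a {ρ} {t} d rewrite rename-as-subst ρ t = D-subst a d

-- Heads short of arguments neither step nor denote, so a replacement of denoting terms cannot have
-- replaced one of them as a whole.
data Inert : Term → Set where
  lam  : ∀ {b} → Inert (ƛ b)
  all  : Inert 𝓐
  rec₀ : Inert 𝓡
  rec₁ : ∀ {g} → Inert (𝓡 · g)
  rec₂ : ∀ {g h} → Inert (𝓡 · g · h)

inert-¬Step : ∀ {D t u} → Inert t → ¬ Step D t u
inert-¬Step rec₁ (app ())
inert-¬Step rec₂ (app (app ()))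

inert-¬Φ : ∀ {D t n} → Inert t → ¬ Φ D t n
inert-¬Φ i@rec₁ (step s _) = inert-¬Step i s
inert-¬Φ i@rec₂ (step s _) = inert-¬Step i s

inert-¬D : ∀ a {t n} → Inert t → ¬ D a t n
inert-¬D a i d = D-inv a d (inert-¬Φ i)

data Spine (u : Term) : Term → Set where
  here : Spine u u
  arg  : ∀ {t v} → Spine u t → Spine u (t · v)

Spine-Step : ∀ {D u u′ t} → Spine u t → Step D u u′ → ∃[ t′ ] (Step D t t′ × Spine u′ t′)
Spine-Step here    s = _ , s , here
Spine-Step (arg p) s = let _ , s′ , p′ = Spine-Step p s in _ , app s′ , arg p′

-- Head reduction has stopped at such a term, and further arguments produce no redex.
data Blocked : Term → Set where
  nil  : Blocked 𝟎
  next : ∀ {t} → Blocked (S t)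
  eq   : ∀ {t u} → Blocked (t ≐ u)
  neg  : ∀ {t} → Blocked (~ t)
  or   : ∀ {t u} → Blocked (t ∨ u)
  all  : ∀ {u} → Blocked (𝓐 · u)
  app  : ∀ {t u} → Blocked t → Blocked (t · u)

blocked-¬Step : ∀ {D t u} → Blocked t → ¬ Step D t u
blocked-¬Step all (app ())
blocked-¬Step (app (app (app ()))) (rec-0 _)
blocked-¬Step (app (app (app ()))) (rec-S _ _)
blocked-¬Step (app b) (app s) = blocked-¬Step b s

blocked-app-¬Φ : ∀ {D t u n} → Blocked t → ¬ Φ D (t · u) n
blocked-app-¬Φ b (step s _) = blocked-¬Step (app b) s

Spine-blocked : ∀ {u t} → Spine u t → Blocked u → Blocked t
Spine-blocked here    b = b
Spine-blocked (arg p) b = app (Spine-blocked p b)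

Φ-view : ∀ {D t n} → Φ D t n → Blocked t ⊎ ∃[ u ] (Step D t u × D u n)
Φ-view nil           = inj₁ nil
Φ-view (next _)      = inj₁ next
Φ-view (equal _ _)   = inj₁ eq
Φ-view (apart _ _ _) = inj₁ eq
Φ-view (neg-1 _)     = inj₁ neg
Φ-view (neg-0 _)     = inj₁ neg
Φ-view (or-1₁ _)     = inj₁ or
Φ-view (or-1₂ _)     = inj₁ or
Φ-view (or-0 _ _)    = inj₁ or
Φ-view (all-1 _)     = inj₁ all
Φ-view (all-0 _ _)   = inj₁ all
Φ-view (step s d)    = inj₂ (_ , s , d)

opaque
  unfolding D

  mutual
    -- Numbers are not functions: by determinism the application must follow the head steps of `u`,
    -- and these end in a blocked term, which has no value when applied further.
    denoting-¬applied : ∀ a b {u t v m k} → D a u m → Spine u t → ¬ D b (t · v) k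
    denoting-¬applied (lim s) (lim s′) d p e =
      d λ (i , φ) → e λ (j , ψ) → denoting-¬appliedᶠ s s′ i j φ p ψ

    denoting-¬appliedᶠ : (s s′ : ℕ → Ord) (i j : ℕ) → ∀ {u t v m k} →
      Φ (D (s i)) u m → Spine u t → ¬ Φ (D (s′ j)) (t · v) k
    denoting-¬appliedᶠ s s′ i j φ p ψ with Φ-view φ
    ... | inj₁ b = blocked-app-¬Φ (Spine-blocked p b) ψ
    ... | inj₂ (_ , st , d) with Spine-Step p st
    ...   | _ , st₁ , p₁ with Φ-view ψ
    ...     | inj₁ all     = inert-¬Step all st₁
    ...     | inj₁ (app b) = blocked-¬Step b st₁
    ...     | inj₂ (_ , st₂ , e)
      with refl ← Step-det (D-det (s i) (s′ j)) (app st₁) st₂ =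
      denoting-¬applied (s i) (s′ j) d p₁ e

-- Replacing denoting subterms by terms with the same value

-- `base` applies under ƛ and to open terms without side condition, because denotations survive
-- renaming and substitution.
data Cong (D : Term → ℕ → Set) : Term → Term → Set where
  base : ∀ {a b n} → D a n → D b n → Cong D a b
  var  : ∀ i → Cong D (var i) (var i)
  bot  : Cong D bot bot
  nil  : Cong D 𝟎 𝟎
  next : ∀ {t t′} → Cong D t t′ → Cong D (S t) (S t′)
  eq   : ∀ {t t′ u u′} → Cong D t t′ → Cong D u u′ → Cong D (t ≐ u) (t′ ≐ u′)
  neg  : ∀ {t t′} → Cong D t t′ → Cong D (~ t) (~ t′)
  or   : ∀ {t t′ u u′} → Cong D t t′ → Cong D u u′ → Cong D (t ∨ u) (t′ ∨ u′)
  lam  : ∀ {t t′} → Cong D t t′ → Cong D (ƛ t) (ƛ t′)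
  app  : ∀ {t t′ u u′} → Cong D t t′ → Cong D u u′ → Cong D (t · u) (t′ · u′)
  rec  : Cong D 𝓡 𝓡
  all  : Cong D 𝓐 𝓐

Cong-refl : ∀ {D} t → Cong D t t
Cong-refl (var i) = var i
Cong-refl bot     = bot
Cong-refl 𝟎       = nil
Cong-refl (S t)   = next (Cong-refl t)
Cong-refl (t ≐ u) = eq (Cong-refl t) (Cong-refl u)
Cong-refl (~ t)   = neg (Cong-refl t)
Cong-refl (t ∨ u) = or (Cong-refl t) (Cong-refl u)
Cong-refl (ƛ t)   = lam (Cong-refl t)
Cong-refl (t · u) = app (Cong-refl t) (Cong-refl u)
Cong-refl 𝓡       = rec
Cong-refl 𝓐       = all

module _ (a : Ord) where

  Cong-rename : ∀ {ρ t t′} → Cong (D a) t t′ → Cong (D a) (rename ρ t) (rename ρ t′)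
  Cong-rename (base d e) = base (D-rename a d) (D-rename a e)
  Cong-rename (var i)    = var _
  Cong-rename bot        = bot
  Cong-rename nil        = nil
  Cong-rename (next c)   = next (Cong-rename c)
  Cong-rename (eq c e)   = eq (Cong-rename c) (Cong-rename e)
  Cong-rename (neg c)    = neg (Cong-rename c)
  Cong-rename (or c e)   = or (Cong-rename c) (Cong-rename e)
  Cong-rename (lam c)    = lam (Cong-rename c)
  Cong-rename (app c e)  = app (Cong-rename c) (Cong-rename e)
  Cong-rename rec        = rec
  Cong-rename all        = all

  Cong-exts : ∀ {σ τ} → (∀ i → Cong (D a) (σ i) (τ i)) →
              ∀ i → Cong (D a) (exts σ i) (exts τ i)
  Cong-exts h zero    = var zero
  Cong-exts h (suc i) = Cong-rename (h i)

  Cong-subst : ∀ {σ τ t t′} → (∀ i → Cong (D a) (σ i) (τ i)) →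
               Cong (D a) t t′ → Cong (D a) (subst σ t) (subst τ t′)
  Cong-subst h (base d e) = base (D-subst a d) (D-subst a e)
  Cong-subst h (var i)    = h i
  Cong-subst h bot        = bot
  Cong-subst h nil        = nil
  Cong-subst h (next c)   = next (Cong-subst h c)
  Cong-subst h (eq c e)   = eq (Cong-subst h c) (Cong-subst h e)
  Cong-subst h (neg c)    = neg (Cong-subst h c)
  Cong-subst h (or c e)   = or (Cong-subst h c) (Cong-subst h e)
  Cong-subst h (lam c)    = lam (Cong-subst (Cong-exts h) c)
  Cong-subst h (app c e)  = app (Cong-subst h c) (Cong-subst h e)
  Cong-subst h rec        = rec
  Cong-subst h all        = all

  Cong-[] : ∀ {b b′ t t′} → Cong (D a) b b′ → Cong (D a) t t′ →
            Cong (D a) (b [ t ]) (b′ [ t′ ])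
  Cong-[] c e = Cong-subst (λ where
    zero    → e
    (suc i) → var i) c

  module _ {D₁ D₂ : Term → ℕ → Set}
           (move : ∀ {t t′ n} → Cong (D a) t t′ → D₁ t n → D₂ t′ n) where

    -- Besides carrying the step over, a replacement may have hit the whole term (`denotes`) or a
    -- proper prefix of its spine (`applied`); the last would make a number act as a function.
    data Outcome : Term → Term → Term → Set where
      reduces : ∀ {t t₁ t′ t₁′} → Step D₂ t′ t₁′ → Cong (D a) t₁ t₁′ → Outcome t t₁ t′
      denotes : ∀ {t t₁ t′ n} → D a t n → D a t′ n → Outcome t t₁ t′
      applied : ∀ {u t v n t₁ t′} → D a u n → Spine u t → Outcome (t · v) t₁ t′

    Step-cong : ∀ {t t₁ t′} → Step D₁ t t₁ → Cong (D a) t t′ →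
      Outcome t t₁ t′
    Step-cong s (base d e) = denotes d e
    -- A replacement at the head of a redex would make a ƛ, or a recursor short of arguments,
    -- denote.
    Step-cong β (app (base d _) _) = ⊥-elim (inert-¬D a lam d)
    Step-cong β (app (lam c) e) = reduces β (Cong-[] c e)
    Step-cong (rec-0 x) (app (base d _) _) = ⊥-elim (inert-¬D a rec₂ d)
    Step-cong (rec-0 x) (app (app (base d _) _) _) = ⊥-elim (inert-¬D a rec₁ d)
    Step-cong (rec-0 x) (app (app (app (base d _) _) _) _) = ⊥-elim (inert-¬D a rec₀ d)
    Step-cong (rec-0 x) (app (app (app rec g) h) t) = reduces (rec-0 (move t x)) g
    Step-cong (rec-S n x) (app (base d _) _) = ⊥-elim (inert-¬D a rec₂ d)
    Step-cong (rec-S n x) (app (app (base d _) _) _) = ⊥-elim (inert-¬D a rec₁ d)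
    Step-cong (rec-S n x) (app (app (app (base d _) _) _) _) = ⊥-elim (inert-¬D a rec₀ d)
    Step-cong (rec-S n x) (app (app (app rec g) h) t) =
      reduces (rec-S n (move t x))
        (app (app h (Cong-refl _)) (app (app (app rec g) h) (Cong-refl _)))
    Step-cong (app s) (app c e) with Step-cong s c
    ... | reduces s′ c′ = reduces (app s′) (app c′ e)
    ... | denotes d _   = applied d here
    ... | applied d p   = applied d (arg p)

    -- Left: the stage is rebuilt from moved parts. Right: the term was itself replaced, and its
    -- value is already known at level `a`.
    Φ-cong : (∀ {u t v m n} → D a u m → Spine u t → ¬ Φ D₁ (t · v) n) →
             (∀ {t m n} → D a t m → Φ D₁ t n → m ≡ n) →
             ∀ {t t′ n} → Cong (D a) t t′ → Φ D₁ t n → Φ D₂ t′ n ⊎ D a t′ n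
    Φ-cong ¬ap det (base d e) φ with refl ← det d φ = inj₂ e
    Φ-cong ¬ap det nil nil = inj₁ nil
    Φ-cong ¬ap det (next c) (next x) = inj₁ (next (move c x))
    Φ-cong ¬ap det (eq c e) (equal x y) = inj₁ (equal (move c x) (move e y))
    Φ-cong ¬ap det (eq c e) (apart x y ne) = inj₁ (apart (move c x) (move e y) ne)
    Φ-cong ¬ap det (neg c) (neg-1 x) = inj₁ (neg-1 (move c x))
    Φ-cong ¬ap det (neg c) (neg-0 x) = inj₁ (neg-0 (move c x))
    Φ-cong ¬ap det (or c e) (or-1₁ x) = inj₁ (or-1₁ (move c x))
    Φ-cong ¬ap det (or c e) (or-1₂ x) = inj₁ (or-1₂ (move e x))
    Φ-cong ¬ap det (or c e) (or-0 x y) = inj₁ (or-0 (move c x) (move e y))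
    Φ-cong ¬ap det (app (base d _) _) (all-1 _) = ⊥-elim (inert-¬D a all d)
    Φ-cong ¬ap det (app (base d _) _) (all-0 _ _) = ⊥-elim (inert-¬D a all d)
    Φ-cong ¬ap det (app all c) (all-1 x) = inj₁ (all-1 λ n → move (app c (Cong-refl _)) (x n))
    Φ-cong ¬ap det (app all c) (all-0 n x) = inj₁ (all-0 n (move (app c (Cong-refl _)) x))
    Φ-cong ¬ap det c φ@(step s x) with Step-cong s c
    ... | reduces s′ c′ = inj₁ (step s′ (move c′ x))
    ... | denotes d e   with refl ← det d φ = inj₂ e
    ... | applied d p   = ⊥-elim (¬ap d p φ)

infixl 6 _⊕_

-- Grafts `a` at the leaves of `b`: a derivation of level `b`, replayed after replacements, may end
-- in values known only at level `a`.
_⊕_ : Ord → Ord → Ord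
a ⊕ zero  = a
a ⊕ lim s = lim λ i → a ⊕ s i

D-⊕ : ∀ a b {t n} → D a t n → D (a ⊕ b) t n
D-⊕ a zero    d = d
D-⊕ a (lim s) d = D-lim (λ i → a ⊕ s i) 0 (D-⊕ a (s 0) d)

opaque
  unfolding D

  D-cong : ∀ a b {t t′ n} → Cong (D a) t t′ → D b t n → D (a ⊕ b) t′ n
  D-cong a (lim s) c d ¬φ = d λ (i , φ) →
    case Φ-cong a (D-cong a (s i))
           -- The stage `ψ` is wrapped as a denotation at `lim s`, to which the facts about `D`
           -- apply.
           (λ e p ψ → denoting-¬applied a (lim s) e p λ k → k (i , ψ))
           (λ e ψ → D-det a (lim s) e λ k → k (i , ψ)) c φ of λ where
      (inj₁ φ′) → ¬φ (i , φ′)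
      (inj₂ e)  → D-⊕ a (lim s) e ¬φ


-- Soundness

suc° : Ord → Ord
suc° a = lim λ _ → a

infixl 5 _⊔_

_⊔_ : Ord → Ord → Ord
a ⊔ b = lim λ where
  zero    → a
  (suc _) → b

opaque
  unfolding D

  D-Φ : ∀ {a t n} → Φ (D a) t n → D (suc° a) t n
  D-Φ φ ¬φ = ¬φ (0 , φ)

D-suc° : ∀ {a t n} → D a t n → D (suc° a) t n
D-suc° {a} = D-lim (λ _ → a) 0

D-⊔ˡ : ∀ {a b t n} → D a t n → D (a ⊔ b) t n
D-⊔ˡ {a} {b} = D-lim _ 0

D-⊔ʳ : ∀ {a b t n} → D b t n → D (a ⊔ b) t n
D-⊔ʳ {a} {b} = D-lim _ 1

num-level : ℕ → Ord
num-level zero    = suc° zero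
num-level (suc n) = suc° (num-level n)

D-num-level : ∀ n → D (num-level n) (num n) n
D-num-level zero    = D-Φ nil
D-num-level (suc n) = D-Φ (next (D-num-level n))

-- One level for all numerals, so that instantiating a quantifier costs the same for every number.
ω : Ord
ω = lim num-level

D-num : ∀ n → D ω (num n) n
D-num n = D-lim num-level n (D-num-level n)

D-num-N : ∀ n → D (suc° ω) (num n N) 1
D-num-N n = D-Φ (equal (D-num n) (D-num n))

▷-subst : ∀ {σ t u} → t ▷ u → subst σ t ▷ subst σ u
▷-subst {σ} (β {b} {t}) rewrite subst-[] {σ} b t = β
▷-subst rec-0 = rec-0
▷-subst {σ} (rec-S n) rewrite subst-num σ n = rec-S n
▷-subst (app s) = app (▷-subst s)

▷⇒Step : ∀ {t u} → t ▷ u → Step (D ω) t u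
▷⇒Step β         = β
▷⇒Step rec-0     = rec-0 (D-num 0)
▷⇒Step (rec-S n) = rec-S n (D-num (suc n))
▷⇒Step (app s)   = app (▷⇒Step s)

D-expand : ∀ {a t u n} → t ▷ u → D a u n → D (suc° (a ⊔ ω)) t n
D-expand {a} s d = D-Φ (step (Step-mono (D-⊔ʳ {a}) (▷⇒Step s)) (D-⊔ˡ d))

-- By determinism the derivation for `t` already contains one for `u`; unlike in expansion, the
-- level does not grow.
D-reduce : ∀ a {t u n} → t ▷ u → D a t n → D a u n
D-reduce a s d = D-inv a d >>= λ φ → case Φ-view φ of λ where
  (inj₁ b)            → ⊥-elim (blocked-¬Step b (▷⇒Step s))
  (inj₂ (_ , s′ , e)) → transport (λ u → D a u _) (Step-det (D-det a ω) s′ (▷⇒Step s)) e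

-- Validity of judgments

Holds : Ord → (ℕ → Term) → Context → Set
Holds a σ = All λ t → D a (subst σ t) 1

hypotheses : Judgment → Context
hypotheses (Γ ⊢ c) = Γ

conclusion : Judgment → Term
conclusion (Γ ⊢ c) = c

-- The level of the conclusion depends on that of the context but not on σ, so
-- that an 𝓐-introduction needs no supremum over its instances.
record Valid (j : Judgment) : Set where
  constructor valid
  field
    bound : ∀ a → ∃[ b ] (∀ σ → Holds a σ (hypotheses j) → D b (subst σ (conclusion j)) 1)

open Valid

Holds-mono : ∀ {a b σ Γ} → (∀ {t n} → D a t n → D b t n) → Holds a σ Γ → Holds b σ Γ
Holds-mono le = All.map le

Holds-• : ∀ {a σ Γ} u → Holds a σ Γ → Holds a (u • σ) (map ↑ Γ)
Holds-• {a} {σ} u h = map⁺ (All.map (λ {t} → transport (λ s → D a s 1) (sym (subst-• u t))) h)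

Holds-≔ : ∀ {a σ i Γ} u → All (λ t → ¬ (i ∈fv t)) Γ → Holds a σ Γ → Holds a (σ [ i ≔ u ]) Γ
Holds-≔ u [] [] = []
Holds-≔ {a} u (_∷_ {x = t} i∉ fr) (d ∷ h) =
  transport (λ s → D a s 1) (sym (≔-fresh t i∉)) d ∷ Holds-≔ u fr h

≔-cong : ∀ {a σ i u w} → Cong (D a) u w → ∀ j → Cong (D a) ((σ [ i ≔ u ]) j) ((σ [ i ≔ w ]) j)
≔-cong {i = i} c j with j ≡ᵇ i
... | true  = c
... | false = Cong-refl _

axiom : ∀ {Γ c} (b : Ord) → (∀ σ → D b (subst σ c) 1) → Valid (Γ ⊢ c)
axiom b f .bound a = b , λ σ _ → f σ

-- `l` turns the level of the premise into that of the conclusion before `σ` is known.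
unary : ∀ {Γ t c} → Valid (Γ ⊢ t) → (l : Ord → Ord) →
        (∀ {b} σ → D b (subst σ t) 1 → D (l b) (subst σ c) 1) →
        Valid (Γ ⊢ c)
unary v l f .bound a = let b , g = v .bound a in l b , λ σ h → f σ (g σ h)

binary : ∀ {Γ t u c} → Valid (Γ ⊢ t) → Valid (Γ ⊢ u) → (l : Ord → Ord) →
         (∀ {b} σ → D b (subst σ t) 1 → D b (subst σ u) 1 → D (l b) (subst σ c) 1) →
         Valid (Γ ⊢ c)
binary v w l f .bound a =
  let b₁ , g = v .bound a ; b₂ , k = w .bound a in
  l (b₁ ⊔ b₂) , λ σ h → f σ (D-⊔ˡ (g σ h)) (D-⊔ʳ {b₁} (k σ h))

N-value : ∀ a {t} → D a (t N) 1 → ¬ ¬ (∃[ n ] D a t n)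
N-value a d k = D-inv a d λ where (equal x _) → k (_ , x)

~-value : ∀ a {t} → D a (~ t) 1 → D a t 0
~-value a d = D-inv a d >>= λ where (neg-1 x) → x

~-intro : ∀ {a t} → D a t 0 → D (suc° a) (~ t) 1
~-intro d = D-Φ (neg-1 d)

sound-RGA : ∀ {ps j} → RGA ps j → All Valid ps → Valid j
sound-RGA hyp [] .bound a = a , λ where σ (d ∷ _) → d
sound-RGA weak (v ∷ []) .bound a = let b , f = v .bound a in b , λ where σ (_ ∷ h) → f σ h
sound-RGA cut (v ∷ w ∷ []) .bound a =
  let b , f = v .bound a ; c , g = w .bound (a ⊔ b) in
  c , λ σ h → g σ (D-⊔ʳ {a} (f σ h) ∷ Holds-mono D-⊔ˡ h)
sound-RGA (sub {Γ} {c} i s) (v ∷ []) .bound a = let b , f = v .bound a in b , λ σ h →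
  transport (λ t → D b t 1) (sym (subst-↦ i s c))
    (f (σ [ i ≔ subst σ s ])
       (All.map (λ {t} → transport (λ u → D a u 1) (subst-↦ i s t)) (map⁻ h)))
sound-RGA true⇒1 (v ∷ []) = unary v (λ b → suc° (b ⊔ ω))
  (λ {b} σ d → D-Φ (equal (D-⊔ˡ d) (D-⊔ʳ {b} (D-num 1))))
sound-RGA 1⇒true (v ∷ []) = unary v id
  (λ {b} σ d → D-inv b d >>= λ where
    (equal x y) → transport (D b _) (D-det b ω y (D-num 1)) x)
sound-RGA false⇒0 (v ∷ []) = unary v (λ b → suc° (b ⊔ ω))
  (λ {b} σ d → D-Φ (equal (D-⊔ˡ (~-value b d)) (D-⊔ʳ {b} (D-num 0))))
sound-RGA 0⇒false (v ∷ []) = unary v suc°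
  (λ {b} σ d → ~-intro (D-inv b d >>= λ where
    (equal x y) → transport (D b _) (D-det b ω y (D-num 0)) x))
sound-RGA explode (v ∷ w ∷ []) = binary v w id
  (λ {b} σ d e → case D-det b b (~-value b d) e of λ ())
sound-RGA ~~-I (v ∷ []) = unary v (λ b → suc° (suc° b)) (λ σ d → ~-intro (D-Φ (neg-0 d)))
sound-RGA ~~-E (v ∷ []) = unary v id
  (λ {b} σ d → D-inv b (~-value b d) >>= λ where (neg-0 x) → x)
sound-RGA ∨-I₁ (v ∷ []) = unary v suc° (λ σ d → D-Φ (or-1₁ d))
sound-RGA ∨-I₂ (v ∷ []) = unary v suc° (λ σ d → D-Φ (or-1₂ d))
sound-RGA ~∨-I (v ∷ w ∷ []) = binary v w (λ b → suc° (suc° b))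
  (λ {b} σ d e → ~-intro (D-Φ (or-0 (~-value b d) (~-value b e))))
-- Which disjunct is true may depend on `σ`, so the levels of both cases are computed and joined
-- beforehand.
sound-RGA ∨-E (v ∷ w₁ ∷ w₂ ∷ []) .bound a =
  let b , f = v .bound a ; c₁ , g₁ = w₁ .bound (b ⊔ a) ; c₂ , g₂ = w₂ .bound (b ⊔ a) in
  c₁ ⊔ c₂ , λ σ h → D-inv b (f σ h) >>= λ where
    (or-1₁ x) → D-⊔ˡ (g₁ σ (D-⊔ˡ x ∷ Holds-mono (D-⊔ʳ {b}) h))
    (or-1₂ x) → D-⊔ʳ {c₁} (g₂ σ (D-⊔ˡ x ∷ Holds-mono (D-⊔ʳ {b}) h))
sound-RGA ~∨-E₁ (v ∷ []) = unary v suc°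
  (λ {b} σ d → ~-intro (D-inv b (~-value b d) >>= λ where (or-0 x _) → x))
sound-RGA ~∨-E₂ (v ∷ []) = unary v suc°
  (λ {b} σ d → ~-intro (D-inv b (~-value b d) >>= λ where (or-0 _ y) → y))
sound-RGA N⇒refl (v ∷ []) = v
sound-RGA refl⇒N (v ∷ []) = v
sound-RGA ≐-sym (v ∷ []) = unary v suc°
  (λ {b} σ d → D-inv b d >>= λ where (equal x y) → D-Φ (equal y x))
-- `t` and `u` share a value, so the two instances of `p` are related by `Cong`.
sound-RGA (≐-repl {a = t} {u} i p) (v ∷ w ∷ []) = binary v w (λ b → b ⊕ b)
  (λ {b} σ d e → D-inv b d >>= λ where
    (equal x y) → transport (λ q → D (b ⊕ b) q 1) (sym (subst-↦ i u p))
      (D-cong b b (Cong-subst b (≔-cong (base x y)) (Cong-refl p))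
        (transport (λ q → D b q 1) (subst-↦ i t p) e)))
sound-RGA ≠-sym (v ∷ []) = unary v (λ b → suc° (suc° b))
  (λ {b} σ d → ~-intro (D-inv b (~-value b d) >>= λ where
    (apart x y ne) → D-Φ (apart y x (ne ∘ sym))))
sound-RGA ≐-B (v ∷ w ∷ []) = binary v w (λ b → suc° (suc° (suc° b)))
  (λ {b} σ d e → N-value b d >>= λ (m , x) → N-value b e >>= λ (n , y) → case m ≟ n of λ where
    (yes refl) → D-Φ (or-1₁ (D-suc° {suc° b} (D-Φ (equal x y))))
    (no ne)    → D-Φ (or-1₂ (~-intro (D-Φ (apart x y ne)))))
sound-RGA (≐-B⁻¹ {a = t} {u}) (v ∷ []) = unary v (λ b → suc° (suc° (suc° (suc° b)))) lemma
  where
  both : ∀ {b t u m n} → D b t m → D b u n → D (suc° (suc° (suc° (suc° b)))) (t N ∧ u N) 1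
  both x y = ~-intro (D-Φ (or-0 (D-Φ (neg-0 (D-Φ (equal x x)))) (D-Φ (neg-0 (D-Φ (equal y y))))))

  lemma : ∀ {b} σ → D b (subst σ ((t ≐ u) B)) 1 →
          D (suc° (suc° (suc° (suc° b)))) (subst σ (t N ∧ u N)) 1
  lemma {b} σ d = D-inv b d >>= λ where
    (or-1₁ x) → D-inv b x >>= λ where (equal y z) → both y z
    (or-1₂ x) → D-inv b (~-value b x) >>= λ where (apart y z _) → both y z
sound-RGA 0-N [] = axiom (suc° ω) (λ σ → D-num-N 0)
sound-RGA S-N (v ∷ []) = unary v (λ b → suc° (suc° b))
  (λ {b} σ d → N-value b d >>= λ (_ , x) → D-Φ (equal (D-Φ (next x)) (D-Φ (next x))))
sound-RGA S-N⁻¹ (v ∷ []) = unary v suc°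
  (λ {b} σ d → N-value b d >>= λ (_ , x) → D-inv b x >>= λ where
    (next y) → D-Φ (equal y y))
sound-RGA S≠0 (v ∷ []) = unary v (λ b → suc° (suc° (suc° b)))
  (λ {b} σ d → N-value b d >>= λ (_ , x) →
    ~-intro (D-Φ (apart (D-Φ (next x)) (D-Φ nil) λ ())))
sound-RGA S-≠ (v ∷ []) = unary v (λ b → suc° (suc° (suc° b)))
  (λ {b} σ d → D-inv b (~-value b d) >>= λ where
    (apart x y ne) → ~-intro (D-Φ (apart (D-Φ (next x)) (D-Φ (next y)) (ne ∘ suc-injective))))
sound-RGA S-≠⁻¹ (v ∷ []) = unary v (λ b → suc° (suc° b))
  (λ {b} σ d → D-inv b (~-value b d) >>= λ where
    (apart x y ne) → D-inv b x >>= λ where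
      (next x′) → D-inv b y >>= λ where
        (next y′) → ~-intro (D-Φ (apart x′ y′ (ne ∘ cong suc))))
sound-RGA S-inj (v ∷ []) = unary v suc°
  (λ {b} σ d → D-inv b d >>= λ where
    (equal x y) → D-inv b x >>= λ where
      (next x′) → D-inv b y >>= λ where
        (next y′) → D-Φ (equal x′ y′))
sound-RGA bot-E (v ∷ []) = unary v id
  (λ {b} σ d → N-value b d >>= λ (_ , x) → D-inv b x >>= λ where (step () _))
-- The value `n` of the induction term varies with `σ`, so the bound is built on the limit over all
-- numeral instances; `D-cong` then exchanges the numeral for the term.
sound-RGA (ind {a = t} i c fresh) (v₀ ∷ v₁ ∷ w ∷ []) .bound a =
  let b , f = w .bound a in ((b ⊔ ω) ⊕ lim level) , λ σ h → N-value b (f σ h) >>= λ (n , x) →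
    transport (λ q → D ((b ⊔ ω) ⊕ lim level) q 1) (sym (subst-↦ i t c))
      (D-cong (b ⊔ ω) (lim level)
        (Cong-subst (b ⊔ ω) (≔-cong (base (D-⊔ʳ {b} (D-num n)) (D-⊔ˡ x))) (Cong-refl c))
        (D-lim level n (instance-true σ h n)))
  where
  -- Every level also covers the context and the numerals, since the step premise is applied again
  -- at each of them.
  level : ℕ → Ord
  level zero    = (a ⊔ suc° ω) ⊔ proj₁ (v₀ .bound a)
  level (suc n) = level n ⊔ proj₁ (v₁ .bound (level n))

  level-≥ : ∀ n {t k} → D (a ⊔ suc° ω) t k → D (level n) t k
  level-≥ zero    d = D-⊔ˡ d
  level-≥ (suc n) d = D-⊔ˡ (level-≥ n d)

  instance-true : ∀ σ → Holds a σ _ → ∀ n → D (level n) (subst (σ [ i ≔ num n ]) c) 1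
  instance-true σ h zero = D-⊔ʳ {a ⊔ suc° ω}
    (transport (λ q → D _ q 1) (subst-↦ i 𝟎 c) (proj₂ (v₀ .bound a) σ h))
  instance-true σ h (suc n) = D-⊔ʳ {level n}
    (transport (λ q → D _ q 1)
      (trans (subst-↦ i (S var i) c)
        (trans (subst-cong (≔-overwrite σ i (num n) _) c)
          (cong (λ u → subst (σ [ i ≔ S u ]) c) (≔-self σ i (num n)))))
      (proj₂ (v₁ .bound (level n)) (σ [ i ≔ num n ])
        ( transport (λ u → D (level n) (u N) 1) (sym (≔-self σ i (num n)))
            (level-≥ n (D-⊔ʳ {a} (D-num-N n)))
        ∷ instance-true σ h n
        ∷ Holds-≔ (num n) fresh (Holds-mono (level-≥ n ∘ D-⊔ˡ) h))))
sound-RGA (conv-exp s) (v ∷ []) = unary v (λ b → suc° (b ⊔ ω)) (λ σ → D-expand (▷-subst s))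
sound-RGA (conv-red s) (v ∷ []) = unary v id (λ {b} σ → D-reduce b (▷-subst s))
sound-RGA (conv-~ s) (v ∷ []) = unary v suc°
  (λ {b} σ d → ~-intro (D-reduce b (▷-subst s) (~-value b d)))
sound-RGA (conv-≐ s) (v ∷ []) = unary v (λ b → suc° (suc° (b ⊔ ω)))
  (λ {b} σ d → N-value b d >>= λ (_ , x) →
    D-Φ (equal (D-expand (▷-subst s) x) (D-suc° {b ⊔ ω} (D-⊔ˡ x))))
sound-RGA rec-≐ (v ∷ w ∷ []) =
  binary v w (λ b → suc° (suc° (suc° (b ⊔ ω) ⊔ ((b ⊔ ω) ⊕ b))))
  (λ {b} σ d e → N-value b d >>= λ (n , x) → N-value b e >>= λ (k , y) →
    -- Exchanging `m` for the numeral of its value turns the right-hand side into the contractum of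
    -- `rec-S`.
    let c = base (D-⊔ˡ x) (D-⊔ʳ {b} (D-num n)) in
    D-Φ (equal
      (D-Φ (step (rec-S n (D-⊔ˡ (D-Φ (next (D-⊔ˡ x)))))
                 (D-⊔ʳ {suc° (b ⊔ ω)} (D-cong (b ⊔ ω) b
                   (app (app (Cong-refl _) c) (app (Cong-refl _) c)) y))))
      (D-suc° {suc° (b ⊔ ω) ⊔ ((b ⊔ ω) ⊕ b)} (D-⊔ˡ (D-suc° {b ⊔ ω} (D-⊔ˡ y))))))
sound-RGA (𝓐-I {f = f}) (v ∷ []) .bound a =
  let b , g = v .bound (suc° ω ⊔ a) in
  -- A single `b` serves all numerals, as the bound of the premise is uniform in the substitution.
  suc° b , λ σ h → D-Φ (all-1 λ n →
    transport (λ u → D b (u · num n) 1) (subst-• (num n) f)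
      (g (num n • σ) (D-⊔ˡ (D-num-N n) ∷ Holds-• (num n) (Holds-mono (D-⊔ʳ {suc° ω}) h))))
sound-RGA 𝓐-E (v ∷ w ∷ []) = binary v w (λ b → (b ⊔ ω) ⊕ b)
  (λ {b} σ d e → N-value b e >>= λ (n , x) → D-inv b d >>= λ where
    (all-1 y) → D-cong (b ⊔ ω) b
      (app (Cong-refl _) (base (D-⊔ʳ {b} (D-num n)) (D-⊔ˡ x))) (y n)
    (step (app ()) _))
sound-RGA ~𝓐-I (v ∷ w ∷ []) = binary v w (λ b → suc° (suc° ((b ⊔ ω) ⊕ b)))
  (λ {b} σ d e → N-value b e >>= λ (n , x) →
    ~-intro (D-Φ (all-0 n (D-cong (b ⊔ ω) b
      (app (Cong-refl _) (base (D-⊔ˡ x) (D-⊔ʳ {b} (D-num n)))) (~-value b d)))))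
sound-RGA (~𝓐-E {f = f} {c}) (v ∷ w ∷ []) .bound a =
  let b , g = v .bound a ; b′ , k = w .bound (suc° ω ⊔ (suc° b ⊔ a)) in
  -- The counterexample `n` is available only under a double negation, which suffices as the goal is
  -- stable; it instantiates the eigenvariable.
  b′ , λ σ h → D-inv b (~-value b (g σ h)) >>= λ where
    (all-0 n x) → transport (λ u → D b′ u 1) (subst-• (num n) c)
      (k (num n • σ)
        ( D-⊔ˡ (D-num-N n)
        ∷ D-⊔ʳ {suc° ω} (D-⊔ˡ (transport (λ u → D (suc° b) (~ (u · num n)) 1)
                                   (sym (subst-• (num n) f)) (~-intro x)))
        ∷ Holds-• (num n) (Holds-mono (D-⊔ʳ {suc° ω} ∘ D-⊔ʳ {suc° b}) h)))
    (step (app ()) _)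

sound-OGA : ∀ {ps j} → OGA ps j → All Valid ps → Valid j
sound-OGA (rga r) vs = sound-RGA r vs
sound-OGA (ATI {u = u}) (v ∷ []) = unary v (λ b → suc° (suc° (suc° b))) λ {b} σ d →
  D-inv b d >>= λ where
    (step (app ()) _)
    (all-1 x) →
      let y = λ n → transport (λ t → D b ((t · num n) B) 1)
                (trans (subst-exts-[] (↑ u) (num n)) (subst-• (num n) u))
                (D-reduce b β (x n)) in
      -- The goal being stable, either some numeral instance is false or none is; if none, all are
      -- true, because the premise decides each of them.
      ¬¬-excluded-middle {A = ∃[ n ] D b (subst σ u · num n) 0} >>= λ where
        (yes (n , z)) → D-Φ (or-1₂ (~-intro (D-Φ (all-0 n z))))
        (no none)     → D-Φ (or-1₁ (D-suc° {suc° b} (D-Φ (all-1 λ n →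
          D-inv b (y n) >>= λ where
            (or-1₁ z) → z
            (or-1₂ z) → ⊥-elim (none (n , ~-value b z))))))

Valid-≋ : ∀ {i j} → i ≋ j → Valid j → Valid i
Valid-≋ {Γ ⊢ _} {Δ ⊢ _} (Γ∼Δ , refl) v .bound a =
  let b , f = v .bound a in
  b , λ σ h → f σ (All.tabulate λ t∈Δ → All.lookup h (Equivalence.from Γ∼Δ t∈Δ))

lookup-≋ : ∀ {j π} → Any (j ≋_) π → All Valid π → Valid j
lookup-≋ (here e)  (v ∷ _)  = Valid-≋ e v
lookup-≋ (there m) (_ ∷ vs) = lookup-≋ m vs

sound-Proof : ∀ {π} → Proof OGA π → All Valid π
sound-Proof []             = []
sound-Proof (r ∷⟨ ms ⟩ p) =
  let vs = sound-Proof p in sound-OGA r (All.map (λ m → lookup-≋ m vs) ms) ∷ vs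

sound : ∀ {j} → Derivable OGA j → Valid j
sound (_ , p , m) = lookup-≋ m (sound-Proof p)

-- Derived rules

≋-refl : ∀ j → j ≋ j
≋-refl (Γ ⊢ c) = mk⇔ id id , refl

module _ {R : RuleSet} where

  -- Entries refer only to later positions of the list, so those of `π` stay justified when `ρ` is
  -- put behind them.
  Proof-++ : ∀ {π ρ} → Proof R π → Proof R ρ → Proof R (π ++ ρ)
  Proof-++ []             q = q
  Proof-++ (r ∷⟨ ms ⟩ p) q = r ∷⟨ All.map ++⁺ˡ ms ⟩ Proof-++ p q

  merge : ∀ {ps} → All (Derivable R) ps → ∃[ π ] (Proof R π × All (λ p → Any (p ≋_) π) ps)
  merge []                   = [] , [] , []
  merge ((π , p , m) ∷ ds) =
    let ρ , q , ms = merge ds in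
    π ++ ρ , Proof-++ p q , ++⁺ˡ m ∷ All.map (++⁺ʳ π) ms

  infer : ∀ {ps j} → R ps j → All (Derivable R) ps → Derivable R j
  infer {j = j} r ds = let π , p , ms = merge ds in j ∷ π , (r ∷⟨ ms ⟩ p) , here (≋-refl j)

by : ∀ {ps j} → RGA ps j → All (Derivable OGA) ps → Derivable OGA j
by r = infer (rga r)

-- A crude bound: sums stand for maxima, and ƛ does not lower it.
fvBound : Term → ℕ
fvBound (var i) = suc i
fvBound bot     = 0
fvBound 𝟎       = 0
fvBound (S t)   = fvBound t
fvBound (t ≐ u) = fvBound t + fvBound u
fvBound (~ t)   = fvBound t
fvBound (t ∨ u) = fvBound t + fvBound u
fvBound (ƛ t)   = fvBound t
fvBound (t · u) = fvBound t + fvBound u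
fvBound 𝓡       = 0
fvBound 𝓐       = 0

mutual
  fv<fvBound : ∀ t {i} → i ∈fv t → i < fvBound t
  fv<fvBound (var i) refl = ≤-refl
  fv<fvBound (S t)   p    = fv<fvBound t p
  fv<fvBound (t ≐ u) p    = fv<fvBound₂ t u p
  fv<fvBound (~ t)   p    = fv<fvBound t p
  fv<fvBound (t ∨ u) p    = fv<fvBound₂ t u p
  fv<fvBound (ƛ t)   p    = <-≤-trans ≤-refl (<⇒≤ (fv<fvBound t p))
  fv<fvBound (t · u) p    = fv<fvBound₂ t u p

  fv<fvBound₂ : ∀ t u {i} → i ∈fv t ⊎ i ∈fv u → i < fvBound t + fvBound u
  fv<fvBound₂ t u (inj₁ p) = <-≤-trans (fv<fvBound t p) (m≤m+n _ _)
  fv<fvBound₂ t u (inj₂ p) = <-≤-trans (fv<fvBound u p) (m≤n+m _ _)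

fresh : ∀ Γ → ∃[ i ] All (λ t → ¬ (i ∈fv t)) Γ
fresh Γ = sum (map fvBound Γ) , ≥⇒fresh Γ ≤-refl
  where
  ≥⇒fresh : ∀ Γ {i} → sum (map fvBound Γ) ≤ i → All (λ t → ¬ (i ∈fv t)) Γ
  ≥⇒fresh []      le = []
  ≥⇒fresh (t ∷ Γ) le =
    (λ p → <-irrefl refl (<-≤-trans (fv<fvBound t p) (≤-trans (m≤m+n _ _) le))) ∷
    ≥⇒fresh Γ (≤-trans (m≤n+m _ _) le)

-- Replacement of `b` by `c` in the pattern `a ≐ var i`; freshness of `i` keeps `a` intact.
≐-trans : ∀ {Γ a b c} → Γ ⊢ᴼ a ≐ b → Γ ⊢ᴼ b ≐ c → Γ ⊢ᴼ a ≐ c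
≐-trans {Γ} {a} d e with fresh (a ∷ [])
... | i , i∉a ∷ [] =
  transport (Γ ⊢ᴼ_) (fill _)
    (by (≐-repl i (a ≐ var i)) (e ∷ transport (Γ ⊢ᴼ_) (sym (fill _)) d ∷ []))
  where
  fill : ∀ u → [ i ↦ u ] (a ≐ var i) ≡ (a ≐ u)
  fill u = cong₂ _≐_ (↦-fresh a i∉a) (≔-self var i u)

≐⇒N : ∀ {Γ a b} → Γ ⊢ᴼ a ≐ b → Γ ⊢ᴼ a N
≐⇒N d = ≐-trans d (by ≐-sym (d ∷ []))

infix 3 _▷*_

_▷*_ : Term → Term → Set
_▷*_ = Star _▷_

N-expand : ∀ {Γ t u} → t ▷* u → Γ ⊢ᴼ u N → Γ ⊢ᴼ t N
N-expand ε        d = d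
N-expand (s ◅ ss) d = ≐⇒N (by (conv-≐ s) (N-expand ss d ∷ []))

-- Conversion under `~` goes only in the direction of reduction, so the negative case passes through
-- equality with 0, which composes with `t ≐ u`.
B-expand : ∀ {Γ t u} → t ▷ u → Γ ⊢ᴼ u B → Γ ⊢ᴼ t B
B-expand s d = by ∨-E (d ∷
  by ∨-I₁ (by (conv-exp s) (by hyp [] ∷ []) ∷ []) ∷
  by ∨-I₂ (by 0⇒false (≐-trans (by (conv-≐ s) (≐⇒N u≐0 ∷ [])) u≐0 ∷ []) ∷ []) ∷ [])
  where u≐0 = by false⇒0 (by hyp [] ∷ [])

B-~ : ∀ {Γ t} → Γ ⊢ᴼ t B → Γ ⊢ᴼ (~ t) B
B-~ d = by ∨-E (d ∷
  by ∨-I₂ (by ~~-I (by hyp [] ∷ []) ∷ []) ∷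
  by ∨-I₁ (by hyp [] ∷ []) ∷ [])

certify : ∀ {Γ u} → var 0 N ∷ map ↑ Γ ⊢ᴼ (↑ u · var 0) B → Γ ⊢ᴼ 𝓐 · (ƛ (↑ u · var 0) B)
certify {Γ} {u} d = by 𝓐-I (by (conv-exp β)
  (transport (λ t → var 0 N ∷ map ↑ Γ ⊢ᴼ (t · var 0) B) (sym unshift) d ∷ []) ∷ [])
  where
  unshift : subst (instβ (var 0)) (rename (ext suc) (↑ u)) ≡ ↑ u
  unshift = trans (subst-rename (λ _ → refl) (↑ u))
    (trans (subst-rename (λ _ → refl) u) (sym (rename-as-subst suc u)))

-- Compiled primitive recursive functions

exts^ : ℕ → (ℕ → Term) → ℕ → Term
exts^ zero    σ = σ
exts^ (suc n) σ = exts^ n (exts σ)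

exts^-∘ : ∀ n {σ τ υ} → (∀ i → subst τ (σ i) ≡ υ i) →
          ∀ i → subst (exts^ n τ) (exts^ n σ i) ≡ exts^ n υ i
exts^-∘ zero    h = h
exts^-∘ (suc n) h = exts^-∘ n (exts-∘ h)

exts^-var : ∀ n {σ} → (∀ i → σ i ≡ var i) → ∀ i → exts^ n σ i ≡ var i
exts^-var zero    h = h
exts^-var (suc n) h = exts^-var n λ where
  zero    → refl
  (suc i) → cong ↑ (h i)

subst-lams : ∀ n {σ} t → subst σ (lams n t) ≡ lams n (subst (exts^ n σ) t)
subst-lams zero    t = refl
subst-lams (suc n) t = cong ƛ_ (subst-lams n t)

·*-cong : ∀ {n t t′} {us us′ : Vec Term n} → t ≡ t′ → us ≡ us′ → t ·* us ≡ t′ ·* us′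
·*-cong refl refl = refl

subst-·* : ∀ {n σ} t (us : Vec Term n) → subst σ (t ·* us) ≡ subst σ t ·* Vec.map (subst σ) us
subst-·* t []       = refl
subst-·* t (u ∷ us) = subst-·* (t · u) us

▷-·* : ∀ {n t u} (us : Vec Term n) → t ▷ u → t ·* us ▷ u ·* us
▷-·* []       s = s
▷-·* (u ∷ us) s = ▷-·* us (app s)

-- The last argument lands at index 0 and the first at the highest index, matching `args`.
env : ∀ {n} → Vec Term n → (ℕ → Term) → ℕ → Term
env []       σ = σ
env (u ∷ us) σ = env us (u • σ)

-- `σ` collects the arguments already consumed, which makes the induction apply after each β-step.
lams-▷*-exts^ : ∀ {n} σ b (us : Vec Term n) →
                lams n (subst (exts^ n σ) b) ·* us ▷* subst (env us σ) b
lams-▷*-exts^ σ b [] = ε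
lams-▷*-exts^ {suc n} σ b (u ∷ us) = ▷-·* us β ◅
  transport (λ t → t ·* us ▷* subst (env us (u • σ)) b) (sym contract) (lams-▷*-exts^ (u • σ) b us)
  where
  contract : lams n (subst (exts^ n (exts σ)) b) [ u ] ≡ lams n (subst (exts^ n (u • σ)) b)
  contract = trans (subst-lams n _) (cong (lams n) (subst-subst (exts^-∘ n (instβ-exts u)) b))

lams-▷* : ∀ {n} b (us : Vec Term n) → lams n b ·* us ▷* subst (env us var) b
lams-▷* {n} b us = transport (λ t → lams n t ·* us ▷* subst (env us var) b)
  (subst-var (exts^-var n λ _ → refl) b) (lams-▷*-exts^ var b us)

env-skip : ∀ {n} (us : Vec Term n) {σ} i → env us σ (n + i) ≡ σ i
env-skip []       i = refl
env-skip {suc n} (u ∷ us) {σ} i = trans (cong (env us (u • σ)) (sym (+-suc n i))) (env-skip us (suc i))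

env-lookup : ∀ {n} (us : Vec Term n) {σ} i → env us σ (toℕ (opposite i)) ≡ lookup us i
env-lookup {suc n} (u ∷ us) {σ} zero =
  trans (cong (env us (u • σ)) (trans (toℕ-fromℕ n) (sym (+-identityʳ n)))) (env-skip us 0)
env-lookup (u ∷ us) {σ} (suc i) =
  trans (cong (env us (u • σ)) (toℕ-inject₁ (opposite i))) (env-lookup us i)

env-args : ∀ {n} {us : Vec Term n} k {σ} {g : Term → Term} →
           (∀ i → σ (k + toℕ (opposite i)) ≡ g (lookup us i)) →
           Vec.map (subst σ) (args k n) ≡ Vec.map g us
env-args {us = us} k {σ} {g} h =
  trans (sym (tabulate-∘ (subst σ) _))
    (trans (tabulate-cong h)
      (trans (tabulate-∘ g (lookup us)) (cong (Vec.map g) (tabulate∘lookup us))))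

args-fresh : ∀ k n i → VecAll.All (λ t → ¬ (k + n + i ∈fv t)) (args k n)
args-fresh k n i = tabulate⁺ λ j p → <⇒≢
  (<-≤-trans (toℕ<n (opposite j)) (m≤m+n n i))
  (+-cancelˡ-≡ k _ _ (trans (sym p) (+-assoc k n i)))

∉fv-·* : ∀ {n i t} (us : Vec Term n) → ¬ (i ∈fv t) → VecAll.All (λ u → ¬ (i ∈fv u)) us →
         ¬ (i ∈fv t ·* us)
∉fv-·* []       t∌ []         = t∌
∉fv-·* (u ∷ us) t∌ (u∌ ∷ us∌) = ∉fv-·* us (λ where
  (inj₁ p) → t∌ p
  (inj₂ p) → u∌ p) us∌

∈fv-lams : ∀ n {i t} → i ∈fv lams n t → n + i ∈fv t
∈fv-lams zero        p = p
∈fv-lams (suc n) {i} {t} p = transport (_∈fv t) (+-suc n i) (∈fv-lams n p)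

mutual
  cmp-closed : ∀ {n} (f : PR n) → Closed (cmp f)
  cmp-closed {n} zer i p = ∈fv-lams n p
  cmp-closed succ i ()
  cmp-closed {n} (proj j) i p = lookup⁺ (args-fresh 0 n i) j (∈fv-lams n p)
  cmp-closed {n} (comp h gs) i p =
    ∉fv-·* (cmpArgs gs) (cmp-closed h _) (cmpArgs-fresh gs i) (∈fv-lams n p)
  cmp-closed (prec {n} g h) i p with ∈fv-lams (suc n) p
  ... | inj₁ (inj₁ (inj₂ q)) =
    ∉fv-·* (args 0 n) (cmp-closed g _)
      (transport (λ m → VecAll.All (λ t → ¬ (m ∈fv t)) (args 0 n)) (+-suc n i)
        (args-fresh 0 n (suc i))) q
  ... | inj₁ (inj₂ q) =
    ∉fv-·* (args 2 n)
      (λ where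
        (inj₁ (inj₁ r)) → cmp-closed h _ r
        (inj₁ (inj₂ ()))
        (inj₂ ()))
      (transport (λ m → VecAll.All (λ t → ¬ (m ∈fv t)) (args 2 n)) (cong (2 +_) (+-suc n i))
        (args-fresh 2 n (suc i))) q
  ... | inj₂ q = <⇒≢ (m≤m+n (suc n) i) (sym q)

  cmpArgs-fresh : ∀ {m n} (gs : Vec (PR n) m) i → VecAll.All (λ t → ¬ (n + i ∈fv t)) (cmpArgs gs)
  cmpArgs-fresh []       i = []
  cmpArgs-fresh {n = n} (g ∷ gs) i =
    ∉fv-·* (args 0 n) (cmp-closed g _) (args-fresh 0 n i) ∷ cmpArgs-fresh gs i

subst-cmp : ∀ {n σ} (f : PR n) → subst σ (cmp f) ≡ cmp f
subst-cmp f = subst-closed (cmp-closed f)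

subst-args : ∀ {n σ} (us : Vec Term n) → Vec.map (subst (env us σ)) (args 0 n) ≡ us
subst-args us = trans (env-args 0 (env-lookup us)) (map-id us)

subst-cmp-args : ∀ {n σ} (f : PR n) (us : Vec Term n) →
                 subst (env us σ) (cmp f ·* args 0 n) ≡ cmp f ·* us
subst-cmp-args {n} f us = trans (subst-·* (cmp f) (args 0 n)) (·*-cong (subst-cmp f) (subst-args us))

applyAll : ∀ {m n} → Vec (PR n) m → Vec Term n → Vec Term m
applyAll gs us = Vec.map (λ g → cmp g ·* us) gs

subst-cmpArgs : ∀ {m n σ} (gs : Vec (PR n) m) (us : Vec Term n) →
                Vec.map (subst (env us σ)) (cmpArgs gs) ≡ applyAll gs us
subst-cmpArgs []       us = refl
subst-cmpArgs (g ∷ gs) us = cong₂ _∷_ (subst-cmp-args g us) (subst-cmpArgs gs us)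

-- The step argument of the recursor in `cmp (prec g h)` once the parameters are substituted,
-- shifted past its two binders.
recStep : ∀ {n} → PR (2 + n) → Vec Term n → Term
recStep h us = ƛ ƛ cmp h · var 1 · var 0 ·* Vec.map (↑ ∘ ↑) us

zer-▷* : ∀ {n} (us : Vec Term n) → cmp (zer {n}) ·* us ▷* 𝟎
zer-▷* us = lams-▷* 𝟎 us

proj-▷* : ∀ {n} i (us : Vec Term n) → cmp (proj i) ·* us ▷* lookup us i
proj-▷* {n} i us = transport (cmp (proj i) ·* us ▷*_)
  (trans (sym (lookup-map i _ (args 0 n))) (cong (λ ts → lookup ts i) (subst-args us)))
  (lams-▷* (lookup (args 0 n) i) us)

comp-▷* : ∀ {m n} (h : PR m) (gs : Vec (PR n) m) us →
          cmp (comp h gs) ·* us ▷* cmp h ·* applyAll gs us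
comp-▷* h gs us = transport (cmp (comp h gs) ·* us ▷*_)
  (trans (subst-·* (cmp h) (cmpArgs gs)) (·*-cong (subst-cmp h) (subst-cmpArgs gs us)))
  (lams-▷* _ us)

prec-▷* : ∀ {n} (g : PR n) h u us →
          cmp (prec g h) ·* (u ∷ us) ▷* 𝓡 · (cmp g ·* us) · recStep h us · u
prec-▷* {n} g h u us = transport (cmp (prec g h) ·* (u ∷ us) ▷*_)
  (cong₂ _·_ (cong₂ _·_ (cong (𝓡 ·_) (subst-cmp-args g us))
                        (cong (ƛ_ ∘ ƛ_) (trans (subst-·* (cmp h · var 1 · var 0) (args 2 n))
                          (·*-cong (cong (λ t → t · var 1 · var 0) (subst-cmp h))
                            (env-args {us = us} 2 {g = ↑ ∘ ↑} (λ i → cong (↑ ∘ ↑) (env-lookup us i)))))))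
             (trans (cong (env us (u • var)) (sym (+-identityʳ n))) (env-skip us 0)))
  (lams-▷* _ (u ∷ us))

recStep-▷* : ∀ {n} (h : PR (2 + n)) us m r → recStep h us · m · r ▷* cmp h ·* (m ∷ r ∷ us)
recStep-▷* h us m r = app β ◅ transport (λ t → (ƛ t) · r ▷* cmp h ·* (m ∷ r ∷ us)) (sym first)
                        (β ◅ transport (_▷* cmp h ·* (m ∷ r ∷ us)) (sym second) ε)
  where
  first : subst (exts (instβ m)) (cmp h · var 1 · var 0 ·* Vec.map (↑ ∘ ↑) us)
        ≡ cmp h · ↑ m · var 0 ·* Vec.map ↑ us
  first = trans (subst-·* (cmp h · var 1 · var 0) (Vec.map (↑ ∘ ↑) us))
    (·*-cong (cong (λ t → t · ↑ m · var 0) (subst-cmp h))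
      (trans (sym (map-∘ (subst (exts (instβ m))) (↑ ∘ ↑) us)) ((map-cong (λ u →
        trans (subst-rename (λ _ → refl) (↑ u))
          (trans (subst-rename (λ _ → refl) u) (sym (rename-as-subst suc u)))) us))))

  second : (cmp h · ↑ m · var 0 ·* Vec.map ↑ us) [ r ] ≡ cmp h · m · r ·* us
  second = trans (subst-·* (cmp h · ↑ m · var 0) (Vec.map ↑ us))
    (·*-cong (cong₂ _·_ (cong₂ _·_ (subst-cmp h) (instβ-↑ r m)) refl)
      (trans (sym (map-∘ (subst (instβ r)) ↑ us)) (trans (map-cong (instβ-↑ r) us) (map-id us))))

-- Totality of the recursion by the induction rule. The assumption on `h` ranges over extensions of
-- `Γ`, as it is used in the context that contains the induction hypothesis.
rec-N : ∀ {Γ g h u} → Γ ⊢ᴼ g N →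
        (∀ {Δ m r} → (∀ {t} → Γ ⊢ᴼ t → Δ ⊢ᴼ t) → Δ ⊢ᴼ m N → Δ ⊢ᴼ r N → Δ ⊢ᴼ (h · m · r) N) →
        Γ ⊢ᴼ u N → Γ ⊢ᴼ (𝓡 · g · h · u) N
rec-N {Γ} {g} {h} {u} g-N h-N u-N with fresh (g ∷ h ∷ Γ)
... | i , i∉g ∷ i∉h ∷ i∉Γ = transport (Γ ⊢ᴼ_) (at u)
  (by (ind i c i∉Γ)
    ( transport (Γ ⊢ᴼ_) (sym (at 𝟎)) (N-expand (rec-0 ◅ ε) g-N)
    ∷ transport (Δ ⊢ᴼ_) (sym (at (S var i))) successor
    ∷ u-N ∷ []))
  where
  c : Term
  c = (𝓡 · g · h · var i) N

  Δ : Context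
  Δ = var i N ∷ c ∷ Γ

  at : ∀ t → [ i ↦ t ] c ≡ (𝓡 · g · h · t) N
  at t = cong _N (cong₂ _·_ (cong₂ _·_ (cong (𝓡 ·_) (↦-fresh g i∉g)) (↦-fresh h i∉h)) (≔-self var i t))

  i-N : Δ ⊢ᴼ var i N
  i-N = by hyp []

  successor : Δ ⊢ᴼ (𝓡 · g · h · (S var i)) N
  successor = ≐⇒N (by rec-≐
    ( i-N
    ∷ h-N (λ d → by weak (by weak (d ∷ []) ∷ [])) i-N (by weak (by hyp [] ∷ []))
    ∷ []))

mutual
  -- Provable totality: an outer induction on the definition, with one use of the induction rule per
  -- primitive recursion.
  cmp-N : ∀ {n Γ} (f : PR n) (us : Vec Term n) → VecAll.All (λ u → Γ ⊢ᴼ u N) us →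
          Γ ⊢ᴼ (cmp f ·* us) N
  cmp-N zer us ds = N-expand (zer-▷* us) (by 0-N [])
  cmp-N succ (u ∷ []) (d ∷ []) = N-expand (β ◅ ε) (by S-N (d ∷ []))
  cmp-N (proj i) us ds = N-expand (proj-▷* i us) (lookup⁺ ds i)
  cmp-N (comp h gs) us ds = N-expand (comp-▷* h gs us) (cmp-N h _ (applyAll-N gs us ds))
  cmp-N (prec g h) (u ∷ us) (d ∷ ds) = N-expand (prec-▷* g h u us)
    (rec-N (cmp-N g us ds)
      (λ up m-N r-N → N-expand (recStep-▷* h us _ _)
        (cmp-N h _ (m-N ∷ r-N ∷ VecAll.map up ds)))
      d)

  applyAll-N : ∀ {m n Γ} (gs : Vec (PR n) m) (us : Vec Term n) → VecAll.All (λ u → Γ ⊢ᴼ u N) us →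
               VecAll.All (λ u → Γ ⊢ᴼ u N) (applyAll gs us)
  applyAll-N []       us ds = []
  applyAll-N (g ∷ gs) us ds = cmp-N g us ds ∷ applyAll-N gs us ds

-- Values of compiled functions

infix 4 _⇓_

_⇓_ : Term → ℕ → Set
t ⇓ n = ∃[ a ] D a t n

⇓-expand : ∀ {t u n} → t ▷* u → u ⇓ n → t ⇓ n
⇓-expand ε        d = d
⇓-expand (s ◅ ss) d = let _ , e = ⇓-expand ss d in _ , D-expand s e

⇓-step : ∀ {a t u n} → Step (D a) t u → u ⇓ n → t ⇓ n
⇓-step {a} s (b , d) = suc° (a ⊔ b) , D-Φ (step (Step-mono D-⊔ˡ s) (D-⊔ʳ {a} d))

mutual
  cmp-⇓ : ∀ {n us ks} (f : PR n) → Pointwise _⇓_ us ks → cmp f ·* us ⇓ eval f ks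
  cmp-⇓ {us = us} zer ds = ⇓-expand (zer-▷* us) (_ , D-Φ {zero} nil)
  cmp-⇓ succ ((_ , d) ∷ []) = ⇓-expand (β ◅ ε) (_ , D-Φ (next d))
  cmp-⇓ {us = us} (proj i) ds = ⇓-expand (proj-▷* i us) (Pointwise.lookup ds i)
  cmp-⇓ {us = us} (comp h gs) ds = ⇓-expand (comp-▷* h gs us) (cmp-⇓ h (applyAll-⇓ gs ds))
  cmp-⇓ {us = u ∷ us} (prec g h) (d ∷ ds) = ⇓-expand (prec-▷* g h u us) (rec-⇓ g h _ d ds)

  applyAll-⇓ : ∀ {m n us ks} (gs : Vec (PR n) m) → Pointwise _⇓_ us ks →
               Pointwise _⇓_ (applyAll gs us) (evals gs ks)
  applyAll-⇓ []       ds = []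
  applyAll-⇓ (g ∷ gs) ds = cmp-⇓ g ds ∷ applyAll-⇓ gs ds

  -- Recursion on the value `k` while `u` varies: after `rec-S` the argument is the numeral of the
  -- predecessor.
  rec-⇓ : ∀ {n us ks} (g : PR n) h k {u} → u ⇓ k → Pointwise _⇓_ us ks →
          𝓡 · (cmp g ·* us) · recStep h us · u ⇓ evalRec g h k ks
  rec-⇓ g h zero    (_ , d) ds = ⇓-step (rec-0 d) (cmp-⇓ g ds)
  rec-⇓ {us = us} g h (suc k) (_ , d) ds = ⇓-step (rec-S k d)
    (⇓-expand (recStep-▷* h us _ _)
      (cmp-⇓ h ((ω , D-num k) ∷ rec-⇓ g h k (ω , D-num k) ds ∷ ds)))

-- Search sentences

rrep-closed : ∀ f → Closed (rrep f)
rrep-closed f i (inj₂ (inj₁ (inj₁ (inj₁ p)))) = cmp-closed f _ p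

miss : StepFunction → Term → Term
miss f t = ƛ cmp f · t · var 0 ≐ 𝟎

rrep-▷ : ∀ f u → rrep f · u ▷ ~ (𝓐 · miss f (↑ u))
rrep-▷ f u = transport (λ c → rrep f · u ▷ ~ (𝓐 · (ƛ c · ↑ u · var 0 ≐ 𝟎))) (subst-cmp f) β

miss-▷ : ∀ f u k → miss f (↑ u) · k ▷ cmp f · u · k ≐ 𝟎
miss-▷ f u k = transport (miss f (↑ u) · k ▷_)
  (cong₂ (λ c t → c · t · k ≐ 𝟎) (subst-cmp f) (instβ-↑ k u)) β

miss-B : ∀ {Γ} f u k → Γ ⊢ᴼ u N → Γ ⊢ᴼ k N → Γ ⊢ᴼ (miss f (↑ u) · k) B
miss-B f u k d e = B-expand (miss-▷ f u k)
  (by ≐-B (cmp-N f (u ∷ k ∷ []) (d ∷ e ∷ []) ∷ by 0-N [] ∷ []))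

-- Decidability travels outwards: from the equation with 𝟎, by totality of `cmp f`, over the steps
-- by `ATI`, through the negation, and to `rrep f` by head expansion.
certified : ∀ f → Certified (rrep f)
certified f = certify
  (transport (λ t → var 0 N ∷ [] ⊢ᴼ (t · var 0) B) (sym (rename-closed (rrep-closed f)))
    (B-expand (rrep-▷ f (var 0)) (B-~ (infer ATI (certify
      -- Under the inner quantifier `var 0` is the step and `var 1` the input, which is `var 2`
      -- inside the ƛ.
      (transport (λ c → var 0 N ∷ var 1 N ∷ [] ⊢ᴼ ((ƛ c · var 2 · var 0 ≐ 𝟎) · var 0) B)
        (sym (rename-closed (cmp-closed f)))
        (miss-B f (var 1) (var 0) (by weak (by hyp [] ∷ [])) (by hyp []))) ∷ [])))))

-- A value 0 would yield an input `n` whose search counts as never hitting; at the actual hit `k`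
-- the compiled function would then have value 0, against `cmp-⇓` and determinism.
𝓐rrep-¬0 : ∀ f → (∀ n → Hits f n) → ∀ a → ¬ D a (𝓐 · rrep f) 0
𝓐rrep-¬0 f hits a d = D-inv a d λ where
  (all-0 n x) → D-inv a (D-reduce a (rrep-▷ f (num n)) x) λ where
    (neg-0 y) → D-inv a y λ where
      (all-1 z) → let k , hit = hits n in
        D-inv a (D-reduce a (miss-▷ f (num n) (num k)) (z k)) λ where
          (equal v w) → let b , e = cmp-⇓ f ((ω , D-num n) ∷ (ω , D-num k) ∷ []) in
            hit (trans (D-det b a e v) (D-det a ω w (D-num 0)))
      (step (app ()) _)
  (step (app ()) _)

theorem6p10 : (f : StepFunction) → ((n : ℕ) → Hits f n) →
    let G = 𝓐 · rrep f in
    ¬ ([] ⊢ᴼ G) →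
    ([] ⊢ᴼ G B) ×
    (¬ ([] ⊢ᴼ ~ G)) ×
    (¬ ([] ⊢ᴼ G)) ×
    GenuineFiction G ×
    (¬ (∃[ c ] ((G ∷ [] ⊢ᴼ c) × (G ∷ [] ⊢ᴼ ~ c))))
theorem6p10 f hits G-unprovable =
  G-B , ~G-unprovable , G-unprovable ,
  (G-closed , (_ , univ (certified f)) , G-unprovable , ~G-unprovable) ,
  consistent
  where
  G : Term
  G = 𝓐 · rrep f

  G-closed : Closed G
  G-closed i (inj₂ p) = rrep-closed f i p

  G-B : [] ⊢ᴼ G B
  G-B = infer ATI (certified f ∷ [])

  ~G-unprovable : ¬ ([] ⊢ᴼ ~ G)
  -- The empty context holds already at level `zero`.
  ~G-unprovable d = let b , g = sound d .bound zero in
    𝓐rrep-¬0 f hits b (~-value b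
      (transport (λ t → D b (~ t) 1) (subst-closed G-closed) (g var [])))

  consistent : ¬ (∃[ c ] ((G ∷ [] ⊢ᴼ c) × (G ∷ [] ⊢ᴼ ~ c)))
  -- By cases on `G B`: under `G` the contradiction yields `~ G`, so `~ G` would be provable
  -- outright.
  consistent (c , d , e) = ~G-unprovable (by ∨-E
    (G-B ∷ by explode (e ∷ d ∷ []) ∷ by hyp [] ∷ []))
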